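{- Let $d \geq 2$ be an integer, $q$ a prime power, and $B(\cdot,\cdot)$ a non-degenerate bilinear form on $\mathbb{F}_q^d$. There exist constants $C, c > 0$, independent of $q$, such that for every prime power $q$ and every set $E \subset \mathbb{F}_q^d$ with $|E| \geq C q^{\,d - \frac{d-1}{3}}$, \[ \left|\{(B(x,y), B(y,z), B(z,x)) : x, y, z \in E\}\right| \geq c\, q^3 . \]
   Context: The notation $X \gg Y$ in the paper means $X \geq CY$ for a positive constant $C$ independent of $q$ (it may depend on the dimension $d$); the hypothesis and conclusion have been written out accordingly. $\mathbb{F}_q$ denotes the finite field with $q$ elements. -}

module Defs where

open import Level using (0ℓ)
open import Data.Nat using (ℕ) renaming (_*_ to _*ℕ_)
open import Data.Product using (_×_; _,_; Σ-syntax)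
open import Data.List using (List; length; deduplicate; map; cartesianProduct)
open import Data.List.Relation.Unary.Unique.Propositional using (Unique)
open import Data.List.Membership.Propositional using (_∈_)
open import Data.Vec using (Vec; zipWith; replicate) renaming (map to vmap)
import Data.Vec.Properties as VecP
open import Relation.Binary.PropositionalEquality using (_≡_)
open import Relation.Binary.Definitions using (DecidableEquality)
open import Relation.Nullary using (¬_)
import Data.Product.Properties as ProdP
open import Algebra.Structures using (IsCommutativeRing)

-- A finite field: a commutative ring (with propositional equality) in which
-- 0 ≠ 1 and every nonzero element has a multiplicative inverse, together
-- with decidable equality and a duplicate-free list of all its elements.
-- Its order is the length of that list (necessarily a prime power, and every
-- prime power occurs, F_q being unique up to isomorphism).
record FiniteField : Set₁ where
  field
    Carrier  : Set
    _+_ _*_  : Carrier → Carrier → Carrier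
    -_       : Carrier → Carrier
    0# 1#    : Carrier
    isCommutativeRing : IsCommutativeRing _≡_ _+_ _*_ -_ 0# 1#
    0≢1      : ¬ (0# ≡ 1#)
    inverse  : ∀ x → ¬ (x ≡ 0#) → Σ[ y ∈ Carrier ] (x * y ≡ 1#)
    _≟_      : DecidableEquality Carrier
    elements : List Carrier
    elements-unique   : Unique elements
    elements-complete : ∀ x → x ∈ elements

  order : ℕ
  order = length elements

module _ (F : FiniteField) where
  open FiniteField F

  Vect : ℕ → Set
  Vect d = Vec Carrier d

  _⊕_ : ∀ {d} → Vect d → Vect d → Vect d
  _⊕_ = zipWith _+_

  _⊙_ : ∀ {d} → Carrier → Vect d → Vect d
  a ⊙ v = vmap (a *_) v

  zeroV : ∀ {d} → Vect d
  zeroV = replicate _ 0#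

  IsBilinear : (d : ℕ) → (Vect d → Vect d → Carrier) → Set
  IsBilinear d B =
      (∀ x x' y → B (x ⊕ x') y ≡ B x y + B x' y)
    × (∀ a x y → B (a ⊙ x) y ≡ a * B x y)
    × (∀ x y y' → B x (y ⊕ y') ≡ B x y + B x y')
    × (∀ a x y → B x (a ⊙ y) ≡ a * B x y)

  IsNonDegenerate : (d : ℕ) → (Vect d → Vect d → Carrier) → Set
  IsNonDegenerate d B =
      (∀ x → (∀ y → B x y ≡ 0#) → x ≡ zeroV)
    × (∀ y → (∀ x → B x y ≡ 0#) → y ≡ zeroV)

  _≟³_ : DecidableEquality (Carrier × Carrier × Carrier)
  _≟³_ = ProdP.≡-dec _≟_ (ProdP.≡-dec _≟_ _≟_)

  triangleTriples : ∀ {d} → (Vect d → Vect d → Carrier) → List (Vect d)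
                  → List (Carrier × Carrier × Carrier)
  triangleTriples B E =
    deduplicate _≟³_
      (map (λ { (x , y , z) → (B x y , B y z , B z x) })
           (cartesianProduct E (cartesianProduct E E)))

  numTriples : ∀ {d} → (Vect d → Vect d → Carrier) → List (Vect d) → ℕ
  numTriples B E = length (triangleTriples B E)

{-# OPTIONS --safe #-}
module Submission where

-- Dilating x, y, z ∈ E along their lines through 0 rescales the three values of the form, so the
-- torus of pairs of units acts on the problem. Fix the value c of B z x ≠ 0, and let D c (a , b) be the
-- deviation from its expectation of the number of (x , y , z) ∈ E³ with values (a , b , c). In the sum of
-- D c (a , b)² one may, by this action, trade the dilations of one pair (x , z) for those of the other before
-- applying Cauchy–Schwarz; one factor then carries only the dilates of a pair (x , z) lying in E, while the
-- other is summed over all pairs of vectors. There, exact equidistribution of linear functionals kills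
-- every contribution except that of proportional y , y′ ∈ E whose ratio is the dilation itself, and fixing
-- the value c forces this ratio to be ±1. Hence Σ D² ≤ 2 q² · q^(2d) · |E|³ (in a normalisation where D
-- carries a factor q²), and a triple (a , b , c) that is not attained contributes (|E| · p)² to this sum, where p
-- is the number of pairs (x , z) ∈ E² with B z x = c; a second moment bound shows that p is about |E|² / q for
-- most c.

open import Defs
open import Algebra.Bundles using (CommutativeRing)
import Algebra.Properties.Ring
open import Data.Bool using (if_then_else_)
open import Data.Integer using (ℤ; +_; 0ℤ; 1ℤ; _+_; _*_; _-_; -_; _≤_; _<_; +≤+; +<+; nonNegative; positive)
open import Data.Integer.Properties hiding (_≟_)
open import Data.Integer.Tactic.RingSolver using (solve-∀)
open import Data.List using (List; []; _∷_; length; filter; cartesianProduct; cartesianProductWith; map; _++_)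
import Data.List.Properties as List
open import Data.List.Membership.Propositional using (_∈_; lose)
open import Data.List.Membership.Propositional.Properties using (∈-filter⁺; ∈-filter⁻; ∈-cartesianProduct⁺; ∈-cartesianProduct⁻; ∈-cartesianProductWith⁺; ∈-map⁺; ∈-deduplicate⁺)
import Data.List.Membership.DecPropositional as DecMembership
open import Data.List.Relation.Unary.All as All using ([])
open import Data.List.Relation.Unary.AllPairs using ([]; _∷_)
open import Data.List.Relation.Unary.Any using (here; there; any?; satisfied)
open import Data.List.Relation.Unary.Unique.Propositional using (Unique)
import Data.List.Relation.Unary.Unique.Propositional.Properties as Unique
open import Data.Nat as ℕ using (ℕ)
import Data.Nat.Properties as ℕP
open import Data.Product using (Σ-syntax; ∃-syntax; _×_; _,_; proj₁; proj₂)
import Data.Product.Properties as Product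
open import Data.Sum using (_⊎_; inj₁; inj₂)
open import Data.Vec using (Vec; []; _∷_)
import Data.Vec.Properties as Vec
open import Function using (_∘_)
open import Level using (0ℓ)
open import Relation.Binary.Definitions using (DecidableEquality)
open import Relation.Binary.PropositionalEquality using (_≡_; _≢_; refl; sym; trans; cong; cong₂; subst; module ≡-Reasoning)
open import Relation.Nullary using (¬_; Dec; yes; no; does; contradiction; ¬?)
open import Relation.Nullary.Decidable using (_×-dec_; decidable-stable)
open import Relation.Unary using (Decidable)

private variable
  X Y : Set
  P R : Set

-- Order and ring facts for integers.

*-nonNeg : ∀ {i j} → 0ℤ ≤ i → 0ℤ ≤ j → 0ℤ ≤ i * j
*-nonNeg {i} {j} p q = subst (_≤ i * j) (*-zeroʳ i) (*-monoˡ-≤-nonNeg i {{nonNegative p}} q)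

*-monoˡ : ∀ {i j k} → 0ℤ ≤ k → i ≤ j → k * i ≤ k * j
*-monoˡ {k = k} p = *-monoˡ-≤-nonNeg k {{nonNegative p}}

*-monoʳ : ∀ {i j k} → 0ℤ ≤ k → i ≤ j → i * k ≤ j * k
*-monoʳ {k = k} p = *-monoʳ-≤-nonNeg k {{nonNegative p}}

*-mono : ∀ {i j k l} → 0ℤ ≤ i → 0ℤ ≤ l → i ≤ j → k ≤ l → i * k ≤ j * l
*-mono p q i≤j k≤l = ≤-trans (*-monoˡ p k≤l) (*-monoʳ q i≤j)

square-nonNeg : ∀ i → 0ℤ ≤ i * i
square-nonNeg i with ≤-total 0ℤ i
... | inj₁ p = *-nonNeg p p
... | inj₂ p = subst (0ℤ ≤_) (neg-square i) (*-nonNeg (neg-mono-≤ p) (neg-mono-≤ p))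
  where
  neg-square : ∀ i → - i * - i ≡ i * i
  neg-square = solve-∀

interchange : ∀ a b c d → (a * b) * (c * d) ≡ (a * c) * (b * d)
interchange = solve-∀

exchange : ∀ a b c → a * (b * c) ≡ b * (a * c)
exchange = solve-∀

double : ∀ i → i + i ≡ + 2 * i
double = solve-∀

i+j-j-j≡i-j : ∀ i j → ((i + j) - j) - j ≡ i - j
i+j-j-j≡i-j = solve-∀

i-k≤i : ∀ {i k} → 0ℤ ≤ k → i - k ≤ i
i-k≤i {i} k≥0 = ≤-trans (+-monoʳ-≤ i (neg-mono-≤ k≥0)) (≤-reflexive (+-identityʳ i))

*-pos : ∀ {i j} → 0ℤ < i → 0ℤ < j → 0ℤ < i * j
*-pos {i} {j} p r = subst (_< i * j) (*-zeroʳ i) (*-monoˡ-<-pos i {{positive p}} r)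

length-cartesianProductWith : ∀ {A B C : Set} (f : A → B → C) xs ys →
  length (cartesianProductWith f xs ys) ≡ length xs ℕ.* length ys
length-cartesianProductWith f []       ys = refl
length-cartesianProductWith f (x ∷ xs) ys = trans (List.length-++ (map (f x) ys))
  (cong₂ ℕ._+_ (List.length-map (f x) ys) (length-cartesianProductWith f xs ys))

-- Integer-valued indicators and finite sums over lists.

⟦_⟧ : Dec P → ℤ
⟦ p ⟧ = if does p then 1ℤ else 0ℤ

⟦⟧-true : (p : Dec P) → P → ⟦ p ⟧ ≡ 1ℤ
⟦⟧-true (yes _) _ = refl
⟦⟧-true (no ¬p) p = contradiction p ¬p

⟦⟧-false : (p : Dec P) → ¬ P → ⟦ p ⟧ ≡ 0ℤ
⟦⟧-false (yes p) ¬p = contradiction p ¬p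
⟦⟧-false (no _)  _  = refl

⟦⟧-nonNeg : (p : Dec P) → 0ℤ ≤ ⟦ p ⟧
⟦⟧-nonNeg (yes _) = +≤+ ℕ.z≤n
⟦⟧-nonNeg (no _)  = ≤-refl

⟦⟧≤1 : (p : Dec P) → ⟦ p ⟧ ≤ 1ℤ
⟦⟧≤1 (yes _) = ≤-refl
⟦⟧≤1 (no _)  = +≤+ ℕ.z≤n

⟦⟧-mono : (p : Dec P) (q : Dec R) → (P → R) → ⟦ p ⟧ ≤ ⟦ q ⟧
⟦⟧-mono (yes p) q f = ≤-reflexive (sym (⟦⟧-true q (f p)))
⟦⟧-mono (no _)  q f = ⟦⟧-nonNeg q

⟦⟧-cong : (p : Dec P) (q : Dec R) → (P → R) → (R → P) → ⟦ p ⟧ ≡ ⟦ q ⟧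
⟦⟧-cong p q f g = ≤-antisym (⟦⟧-mono p q f) (⟦⟧-mono q p g)

∑ : List X → (X → ℤ) → ℤ
∑ []       f = 0ℤ
∑ (x ∷ xs) f = f x + ∑ xs f

syntax ∑ xs (λ x → t) = ∑[ x ∈ xs ] t

∑-cong-∈ : ∀ (xs : List X) {f g} → (∀ {x} → x ∈ xs → f x ≡ g x) → ∑ xs f ≡ ∑ xs g
∑-cong-∈ []       e = refl
∑-cong-∈ (x ∷ xs) e = cong₂ _+_ (e (here refl)) (∑-cong-∈ xs (e ∘ there))

∑-cong : ∀ (xs : List X) {f g} → (∀ x → f x ≡ g x) → ∑ xs f ≡ ∑ xs g
∑-cong xs e = ∑-cong-∈ xs λ {x} _ → e x

∑-mono-∈ : ∀ (xs : List X) {f g} → (∀ {x} → x ∈ xs → f x ≤ g x) → ∑ xs f ≤ ∑ xs g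
∑-mono-∈ []       e = ≤-refl
∑-mono-∈ (x ∷ xs) e = +-mono-≤ (e (here refl)) (∑-mono-∈ xs (e ∘ there))

∑-mono : ∀ (xs : List X) {f g} → (∀ x → f x ≤ g x) → ∑ xs f ≤ ∑ xs g
∑-mono xs e = ∑-mono-∈ xs λ {x} _ → e x

∑-0 : ∀ (xs : List X) → ∑ xs (λ _ → 0ℤ) ≡ 0ℤ
∑-0 []       = refl
∑-0 (x ∷ xs) = trans (+-identityˡ _) (∑-0 xs)

∑-nonNeg : ∀ (xs : List X) {f} → (∀ x → 0ℤ ≤ f x) → 0ℤ ≤ ∑ xs f
∑-nonNeg xs {f} e = subst (_≤ ∑ xs f) (∑-0 xs) (∑-mono xs e)

∑-+ : ∀ (xs : List X) f g → (∑[ x ∈ xs ] (f x + g x)) ≡ ∑ xs f + ∑ xs g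
∑-+ []       f g = refl
∑-+ (x ∷ xs) f g = trans (cong (λ s → (f x + g x) + s) (∑-+ xs f g)) (medial (f x) (g x) (∑ xs f) (∑ xs g))
  where
  medial : ∀ a b c d → (a + b) + (c + d) ≡ (a + c) + (b + d)
  medial = solve-∀

∑-*ˡ : ∀ (xs : List X) c f → (∑[ x ∈ xs ] (c * f x)) ≡ c * ∑ xs f
∑-*ˡ []       c f = sym (*-zeroʳ c)
∑-*ˡ (x ∷ xs) c f = trans (cong (λ s → c * f x + s) (∑-*ˡ xs c f)) (sym (*-distribˡ-+ c (f x) (∑ xs f)))

∑-*ʳ : ∀ (xs : List X) c f → (∑[ x ∈ xs ] (f x * c)) ≡ ∑ xs f * c
∑-*ʳ xs c f = trans (∑-cong xs λ x → *-comm (f x) c) (trans (∑-*ˡ xs c f) (*-comm c _))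

∑-- : ∀ (xs : List X) f g → (∑[ x ∈ xs ] (f x - g x)) ≡ ∑ xs f - ∑ xs g
∑-- xs f g = trans (∑-+ xs f (λ x → - g x)) (cong (λ v → ∑ xs f + v) neg)
  where
  neg : (∑[ x ∈ xs ] (- g x)) ≡ - ∑ xs g
  neg = trans (∑-cong xs λ x → sym (-1*i≡-i (g x))) (trans (∑-*ˡ xs (- 1ℤ) g) (-1*i≡-i (∑ xs g)))

∑-swap : ∀ (xs : List X) (ys : List Y) (f : X → Y → ℤ) → (∑[ x ∈ xs ] ∑[ y ∈ ys ] f x y) ≡ (∑[ y ∈ ys ] ∑[ x ∈ xs ] f x y)
∑-swap []       ys f = sym (∑-0 ys)
∑-swap (x ∷ xs) ys f = trans (cong (λ v → ∑ ys (f x) + v) (∑-swap xs ys f)) (sym (∑-+ ys (f x) _))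

∑-*-∑ : ∀ (xs : List X) (ys : List Y) f g → ∑ xs f * ∑ ys g ≡ (∑[ x ∈ xs ] ∑[ y ∈ ys ] (f x * g y))
∑-*-∑ xs ys f g = trans (sym (∑-*ʳ xs (∑ ys g) f)) (∑-cong xs λ x → sym (∑-*ˡ ys (f x) g))

∑-++ : ∀ (xs ys : List X) f → ∑ (xs ++ ys) f ≡ ∑ xs f + ∑ ys f
∑-++ []       ys f = sym (+-identityˡ _)
∑-++ (x ∷ xs) ys f = trans (cong (λ v → f x + v) (∑-++ xs ys f)) (sym (+-assoc (f x) _ _))

∑-map : ∀ (xs : List X) (h : X → Y) f → ∑ (map h xs) f ≡ ∑ xs (f ∘ h)
∑-map []       h f = refl
∑-map (x ∷ xs) h f = cong (λ v → f (h x) + v) (∑-map xs h f)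

∑-cartesianProduct : ∀ (xs : List X) (ys : List Y) f → ∑ (cartesianProduct xs ys) f ≡ (∑[ x ∈ xs ] ∑[ y ∈ ys ] f (x , y))
∑-cartesianProduct []       ys f = refl
∑-cartesianProduct (x ∷ xs) ys f = trans (∑-++ (map (x ,_) ys) _ f) (cong₂ _+_ (∑-map ys (x ,_) f) (∑-cartesianProduct xs ys f))

∑-filter : ∀ {P : X → Set} (P? : Decidable P) (xs : List X) f → ∑ (filter P? xs) f ≡ (∑[ x ∈ xs ] (⟦ P? x ⟧ * f x))
∑-filter P? []       f = refl
∑-filter P? (x ∷ xs) f with P? x
... | yes _ = cong₂ _+_ (sym (*-identityˡ (f x))) (∑-filter P? xs f)
... | no  _ = trans (∑-filter P? xs f) (sym (+-identityˡ _))

card : List X → ℤ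
card xs = ∑[ _ ∈ xs ] 1ℤ

card≡length : (xs : List X) → card xs ≡ + length xs
card≡length []       = refl
card≡length (x ∷ xs) = cong (λ v → 1ℤ + v) (card≡length xs)

∑-const : ∀ (xs : List X) c → (∑[ _ ∈ xs ] c) ≡ card xs * c
∑-const xs c = trans (∑-cong xs λ _ → sym (*-identityˡ c)) (∑-*ʳ xs c (λ _ → 1ℤ))

card-nonNeg : (xs : List X) → 0ℤ ≤ card xs
card-nonNeg xs = ∑-nonNeg xs λ _ → +≤+ ℕ.z≤n

0<card : ∀ {a : X} {xs} → a ∈ xs → 0ℤ < card xs
0<card {xs = x ∷ xs} _ = <-≤-trans (+<+ (ℕ.s≤s ℕ.z≤n)) (≤-trans (≤-reflexive (sym (+-identityʳ 1ℤ))) (+-monoʳ-≤ 1ℤ (card-nonNeg xs)))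

card-cartesianProduct : ∀ (xs : List X) (ys : List Y) → card (cartesianProduct xs ys) ≡ card xs * card ys
card-cartesianProduct xs ys = trans (∑-cartesianProduct xs ys (λ _ → 1ℤ)) (∑-const xs (card ys))

module _ (_≟_ : DecidableEquality X) where

  ∑-δ-∉ : ∀ (xs : List X) a (f : X → ℤ) → (∀ {x} → x ∈ xs → x ≢ a) → (∑[ x ∈ xs ] (⟦ x ≟ a ⟧ * f x)) ≡ 0ℤ
  ∑-δ-∉ xs a f a∉ = trans (∑-cong-∈ xs λ {x} i → cong (_* f x) (⟦⟧-false (x ≟ a) (a∉ i))) (∑-0 xs)

  ∑-δ : ∀ {xs : List X} {a} (f : X → ℤ) → Unique xs → a ∈ xs → (∑[ x ∈ xs ] (⟦ x ≟ a ⟧ * f x)) ≡ f a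
  ∑-δ {x ∷ xs} f (x∉ ∷ u) (here refl) = trans
    (cong₂ _+_ (trans (cong (_* f x) (⟦⟧-true (x ≟ x) refl)) (*-identityˡ _))
      (∑-δ-∉ xs x f λ i e → All.lookup x∉ i (sym e))) (+-identityʳ _)
  ∑-δ {x ∷ xs} {a} f (x∉ ∷ u) (there i) = trans
    (cong₂ _+_ (cong (_* f x) (⟦⟧-false (x ≟ a) (All.lookup x∉ i))) (∑-δ f u i)) (+-identityˡ _)

  ∑-⟦⟧-unique : ∀ {xs : List X} {a} → Unique xs → a ∈ xs → (∑[ x ∈ xs ] ⟦ x ≟ a ⟧) ≡ 1ℤ
  ∑-⟦⟧-unique {xs} u i = trans (∑-cong xs λ _ → sym (*-identityʳ _)) (∑-δ (λ _ → 1ℤ) u i)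

  ∑-⟦⟧≤1 : ∀ {xs : List X} a → Unique xs → (∑[ x ∈ xs ] ⟦ x ≟ a ⟧) ≤ 1ℤ
  ∑-⟦⟧≤1 {xs = []} a u = +≤+ ℕ.z≤n
  ∑-⟦⟧≤1 {x ∷ xs} a (x∉ ∷ u) with x ≟ a
  ... | no  _    = subst (_≤ 1ℤ) (sym (+-identityˡ _)) (∑-⟦⟧≤1 a u)
  ... | yes refl = ≤-reflexive (trans (cong (λ v → 1ℤ + v)
    (trans (∑-cong xs λ _ → sym (*-identityʳ _)) (∑-δ-∉ xs x (λ _ → 1ℤ) λ i e → All.lookup x∉ i (sym e)))) refl)

  1≤∑-⟦⟧ : ∀ {xs : List X} {a} → a ∈ xs → 1ℤ ≤ (∑[ x ∈ xs ] ⟦ a ≟ x ⟧)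
  1≤∑-⟦⟧ {x ∷ xs} {a} (here e)  = +-mono-≤ (≤-reflexive (sym (⟦⟧-true (a ≟ x) e))) (∑-nonNeg xs λ x → ⟦⟧-nonNeg (a ≟ x))
  1≤∑-⟦⟧ {x ∷ xs} {a} (there i) = +-mono-≤ (⟦⟧-nonNeg (a ≟ x)) (1≤∑-⟦⟧ i)

  -- Write `f (φ x)` as a delta sum over `w` and exchange the sums: the fibre of `φ` over `w` is the
  -- single point `φ⁻¹ w`.
  ∑-reindex : ∀ {xs : List X} (φ φ⁻¹ : X → X) → Unique xs →
    (∀ {x} → x ∈ xs → φ x ∈ xs) → (∀ {x} → x ∈ xs → φ⁻¹ x ∈ xs) →
    (∀ {x} → x ∈ xs → φ (φ⁻¹ x) ≡ x) → (∀ {x} → x ∈ xs → φ⁻¹ (φ x) ≡ x) →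
    ∀ f → ∑ xs (f ∘ φ) ≡ ∑ xs f
  ∑-reindex {xs} φ φ⁻¹ u φ∈ φ⁻¹∈ φφ⁻¹ φ⁻¹φ f = begin
    ∑ xs (f ∘ φ)                                       ≡⟨ ∑-cong-∈ xs (λ i → sym (∑-δ f u (φ∈ i))) ⟩
    (∑[ x ∈ xs ] ∑[ w ∈ xs ] (⟦ w ≟ φ x ⟧ * f w))      ≡⟨ ∑-swap xs xs _ ⟩
    (∑[ w ∈ xs ] ∑[ x ∈ xs ] (⟦ w ≟ φ x ⟧ * f w))      ≡⟨ ∑-cong xs (λ w → ∑-*ʳ xs (f w) _) ⟩
    (∑[ w ∈ xs ] ((∑[ x ∈ xs ] ⟦ w ≟ φ x ⟧) * f w))    ≡⟨ ∑-cong-∈ xs fibre ⟩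
    ∑ xs f                                             ∎
    where
    open ≡-Reasoning
    fibre : ∀ {w} → w ∈ xs → (∑[ x ∈ xs ] ⟦ w ≟ φ x ⟧) * f w ≡ f w
    fibre {w} i = trans (cong (_* f w) (trans
      (∑-cong-∈ xs λ {x} j → ⟦⟧-cong (w ≟ φ x) (x ≟ φ⁻¹ w)
        (λ e → trans (sym (φ⁻¹φ j)) (cong φ⁻¹ (sym e)))
        (λ e → trans (sym (φφ⁻¹ i)) (cong φ (sym e))))
      (∑-⟦⟧-unique u (φ⁻¹∈ i)))) (*-identityˡ (f w))

  -- Double counting of the pairs `x ≡ l` with `x` in `xs` and `l` in `E`: each `l` is met exactly
  -- once in `xs`, and each `x` at most once in `E`.
  ∑-membership≥length : ∀ {xs E : List X} {t : X → ℤ} → Unique xs → Unique E → (∀ {x} → x ∈ E → x ∈ xs) →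
    (∀ x → (x ∈ E → 1ℤ ≤ t x) × 0ℤ ≤ t x) → + length E ≤ ∑ xs t
  ∑-membership≥length {xs} {E} {t} xs! E! E⊆ t≥ = begin
    + length E                         ≡⟨ sym (card≡length E) ⟩
    (∑[ l ∈ E ] 1ℤ)                    ≡⟨ ∑-cong-∈ E (λ i → sym (∑-⟦⟧-unique xs! (E⊆ i))) ⟩
    (∑[ l ∈ E ] ∑[ x ∈ xs ] ⟦ x ≟ l ⟧) ≡⟨ ∑-swap E xs _ ⟩
    (∑[ x ∈ xs ] ∑[ l ∈ E ] ⟦ x ≟ l ⟧) ≤⟨ ∑-mono xs bound ⟩
    ∑ xs t                             ∎
    where
    open ≤-Reasoning
    bound : ∀ x → (∑[ l ∈ E ] ⟦ x ≟ l ⟧) ≤ t x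
    bound x with any? (x ≟_) E
    ... | yes x∈E = ≤-trans (≤-reflexive (∑-cong E λ l → ⟦⟧-cong (x ≟ l) (l ≟ x) sym sym)) (≤-trans (∑-⟦⟧≤1 x E!) (proj₁ (t≥ x) x∈E))
    ... | no x∉E  = ≤-trans (≤-reflexive (trans (∑-cong-∈ E λ {l} i → ⟦⟧-false (x ≟ l) λ { refl → x∉E i }) (∑-0 E))) (proj₂ (t≥ x))

  -- The bound on `t x` is the multiplicity of `x` in `L`; summed over the duplicate-free `xs`, it
  -- counts each entry of `L` at most once.
  ∑-membership≤length : ∀ {xs : List X} (L : List X) {t : X → ℤ} → Unique xs →
    (∀ x → t x ≤ (∑[ l ∈ L ] ⟦ x ≟ l ⟧)) → ∑ xs t ≤ + length L
  ∑-membership≤length {xs} L {t} u t≤ = begin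
    ∑ xs t                             ≤⟨ ∑-mono xs t≤ ⟩
    (∑[ x ∈ xs ] ∑[ l ∈ L ] ⟦ x ≟ l ⟧) ≡⟨ ∑-swap xs L _ ⟩
    (∑[ l ∈ L ] ∑[ x ∈ xs ] ⟦ x ≟ l ⟧) ≤⟨ ∑-mono L (λ l → ∑-⟦⟧≤1 l u) ⟩
    card L                             ≡⟨ card≡length L ⟩
    + length L                         ∎
    where open ≤-Reasoning

-- Expand the nonnegative double sum of `(u i j - u j i)²`. Transposition preserves the sum of
-- squares, so the result is twice the difference of the two sides.
∑∑-transpose≤∑∑-square : ∀ (xs : List X) (u : X → X → ℤ) →
  (∑[ i ∈ xs ] ∑[ j ∈ xs ] (u i j * u j i)) ≤ (∑[ i ∈ xs ] ∑[ j ∈ xs ] (u i j * u i j))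
∑∑-transpose≤∑∑-square xs u = *-cancelˡ-≤-pos _ _ (+ 2) (0≤i-j⇒j≤i (subst (0ℤ ≤_) eq
    (∑-nonNeg xs λ i → ∑-nonNeg xs λ j → square-nonNeg (u i j - u j i))))
  where
  open ≡-Reasoning
  S T : ℤ
  S = ∑[ i ∈ xs ] ∑[ j ∈ xs ] (u i j * u i j)
  T = ∑[ i ∈ xs ] ∑[ j ∈ xs ] (u i j * u j i)
  expand : ∀ a b → (a - b) * (a - b) ≡ (a * a + b * b) - + 2 * (a * b)
  expand = solve-∀
  eq : (∑[ i ∈ xs ] ∑[ j ∈ xs ] ((u i j - u j i) * (u i j - u j i))) ≡ + 2 * S - + 2 * T
  eq = begin
    (∑[ i ∈ xs ] ∑[ j ∈ xs ] ((u i j - u j i) * (u i j - u j i)))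
      ≡⟨ ∑-cong xs (λ i → trans (∑-cong xs λ j → expand (u i j) (u j i))
           (trans (∑-- xs _ _) (cong₂ _-_ (∑-+ xs _ _) (∑-*ˡ xs (+ 2) _)))) ⟩
    (∑[ i ∈ xs ] (((∑[ j ∈ xs ] (u i j * u i j)) + (∑[ j ∈ xs ] (u j i * u j i))) - + 2 * (∑[ j ∈ xs ] (u i j * u j i))))
      ≡⟨ trans (∑-- xs _ _) (cong₂ _-_ (∑-+ xs _ _) (∑-*ˡ xs (+ 2) _)) ⟩
    (S + (∑[ i ∈ xs ] ∑[ j ∈ xs ] (u j i * u j i))) - + 2 * T
      ≡⟨ cong (λ s → (S + s) - + 2 * T) (∑-swap xs xs _) ⟩
    (S + S) - + 2 * T ≡⟨ cong (_- + 2 * T) (double S) ⟩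
    + 2 * S - + 2 * T ∎

-- Lagrange's identity: the double sum of `w x * w y * (f x - f y)²` is twice the difference of the
-- two sides.
∑-CauchySchwarz : ∀ (xs : List X) (w f : X → ℤ) → (∀ x → 0ℤ ≤ w x) →
  (∑[ x ∈ xs ] (w x * f x)) * (∑[ x ∈ xs ] (w x * f x)) ≤ ∑ xs w * (∑[ x ∈ xs ] (w x * (f x * f x)))
∑-CauchySchwarz xs w f w≥0 = *-cancelˡ-≤-pos _ _ (+ 2) (0≤i-j⇒j≤i (subst (0ℤ ≤_) eq
    (∑-nonNeg xs λ x → ∑-nonNeg xs λ y → *-nonNeg (*-nonNeg (w≥0 x) (w≥0 y)) (square-nonNeg (f x - f y)))))
  where
  open ≡-Reasoning
  W F G : ℤ
  W = ∑ xs w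
  F = ∑[ x ∈ xs ] (w x * f x)
  G = ∑[ x ∈ xs ] (w x * (f x * f x))
  expand : ∀ a b s t → (a * b) * ((s - t) * (s - t)) ≡ (a * (b * (t * t)) + (a * (s * s)) * b) - (+ 2 * (a * s)) * (b * t)
  expand = solve-∀
  collect : ∀ s t r → (s * t + t * s) - (+ 2 * r) * r ≡ + 2 * (s * t) - + 2 * (r * r)
  collect = solve-∀
  eq : (∑[ x ∈ xs ] ∑[ y ∈ xs ] ((w x * w y) * ((f x - f y) * (f x - f y)))) ≡ + 2 * (W * G) - + 2 * (F * F)
  eq = begin
    (∑[ x ∈ xs ] ∑[ y ∈ xs ] ((w x * w y) * ((f x - f y) * (f x - f y))))
      ≡⟨ ∑-cong xs (λ x → trans (∑-cong xs λ y → expand (w x) (w y) (f x) (f y))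
           (trans (∑-- xs _ _) (cong₂ _-_ (trans (∑-+ xs _ _) (cong₂ _+_ (∑-*ˡ xs (w x) _) (∑-*ˡ xs (w x * (f x * f x)) w))) (∑-*ˡ xs (+ 2 * (w x * f x)) _)))) ⟩
    (∑[ x ∈ xs ] ((w x * G + (w x * (f x * f x)) * W) - (+ 2 * (w x * f x)) * F))
      ≡⟨ trans (∑-- xs _ _) (cong₂ _-_ (trans (∑-+ xs _ _) (cong₂ _+_ (∑-*ʳ xs G w) (∑-*ʳ xs W _)))
           (trans (∑-*ʳ xs F _) (cong (_* F) (∑-*ˡ xs (+ 2) _)))) ⟩
    (W * G + G * W) - (+ 2 * F) * F ≡⟨ collect W G F ⟩
    + 2 * (W * G) - + 2 * (F * F) ∎

-- Cauchy-Schwarz along the orbits of a commutative action.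

module GroupAction {I T : Set} (is : List I) (ts : List T) (_·_ : T → I → I) (_∙_ : T → T → T)
  (∙-assoc : ∀ s t u → (s ∙ t) ∙ u ≡ s ∙ (t ∙ u)) (∙-comm : ∀ s t → s ∙ t ≡ t ∙ s)
  (∑-· : ∀ {t} → t ∈ ts → ∀ f → (∑[ i ∈ is ] f (t · i)) ≡ ∑ is f)
  (∑-∙ : ∀ {t} → t ∈ ts → ∀ f → (∑[ s ∈ ts ] f (t ∙ s)) ≡ ∑ ts f)
  (N : I → T → ℤ) (N-equivariant : ∀ {t} → t ∈ ts → ∀ i s → N (t · i) (t ∙ s) ≡ N i s)
  where

  -- Acting by t on (i , s) and by t′ on (j , s) turns N i s * N j s into N i (t′ ∙ s) * N j (t ∙ s);
  -- Cauchy–Schwarz then separates the orbit of i from N j.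
  orbit-CauchySchwarz : ∀ (ω : I → ℤ) →
    (card ts * card ts) * (∑[ s ∈ ts ] ((∑[ i ∈ is ] (ω i * N i s)) * (∑[ i ∈ is ] (ω i * N i s))))
    ≤ (∑[ s ∈ ts ] ∑[ i ∈ is ] ∑[ j ∈ is ]
        ((∑[ t ∈ ts ] (ω (t · i) * N j (t ∙ s))) * (∑[ t ∈ ts ] (ω (t · i) * N j (t ∙ s)))))
  orbit-CauchySchwarz ω = begin
    (card ts * card ts) * (∑[ s ∈ ts ] (D s * D s))
      ≡⟨ trans (*-assoc (card ts) (card ts) _) (trans (sym (∑-const ts _)) (∑-cong ts λ _ → sym (∑-const ts _))) ⟩
    (∑[ t ∈ ts ] ∑[ t′ ∈ ts ] ∑[ s ∈ ts ] (D s * D s))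
      ≡⟨ ∑-cong-∈ ts (λ t∈ → ∑-cong-∈ ts λ t′∈ → twist t∈ t′∈) ⟩
    (∑[ t ∈ ts ] ∑[ t′ ∈ ts ] ∑[ s ∈ ts ] ∑[ i ∈ is ] ∑[ j ∈ is ] summand t t′ s i j)
      ≡⟨ trans (∑-cong ts λ t → ∑-swap ts ts _) (∑-swap ts ts _) ⟩
    (∑[ s ∈ ts ] ∑[ t ∈ ts ] ∑[ t′ ∈ ts ] ∑[ i ∈ is ] ∑[ j ∈ is ] summand t t′ s i j)
      ≡⟨ ∑-cong ts regroup ⟩
    (∑[ s ∈ ts ] ∑[ i ∈ is ] ∑[ j ∈ is ] (U s i j * U s j i))
      ≤⟨ ∑-mono ts (λ s → ∑∑-transpose≤∑∑-square is (U s)) ⟩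
    (∑[ s ∈ ts ] ∑[ i ∈ is ] ∑[ j ∈ is ] (U s i j * U s i j)) ∎
    where
    open ≤-Reasoning
    D : T → ℤ
    D s = ∑[ i ∈ is ] (ω i * N i s)
    U : T → I → I → ℤ
    U s i j = ∑[ t ∈ ts ] (ω (t · i) * N j (t ∙ s))
    summand : T → T → T → I → I → ℤ
    summand t t′ s i j = (ω (t · i) * N j (t ∙ s)) * (ω (t′ · j) * N i (t′ ∙ s))
    D-shift : ∀ {t} → t ∈ ts → ∀ s → D (t ∙ s) ≡ (∑[ i ∈ is ] (ω (t · i) * N i s))
    D-shift {t} t∈ s = trans (sym (∑-· t∈ _)) (∑-cong is λ i → cong (ω (t · i) *_) (N-equivariant t∈ i s))
    crossover : ∀ a b c d → (a * b) * (c * d) ≡ (a * d) * (c * b)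
    crossover = solve-∀
    twist : ∀ {t t′} → t ∈ ts → t′ ∈ ts → (∑[ s ∈ ts ] (D s * D s)) ≡ (∑[ s ∈ ts ] ∑[ i ∈ is ] ∑[ j ∈ is ] summand t t′ s i j)
    twist {t} {t′} t∈ t′∈ = begin-equality
      -- Both copies of `D` are moved to `t ∙ (t′ ∙ s)`. By commutativity the first can then shed
      -- `t` and the second `t′`, each keeping the other's dilation.
      (∑[ s ∈ ts ] (D s * D s)) ≡⟨ sym (trans (∑-∙ t′∈ _) (∑-∙ t∈ (λ s → D s * D s))) ⟩
      (∑[ s ∈ ts ] (D (t ∙ (t′ ∙ s)) * D (t ∙ (t′ ∙ s))))
        ≡⟨ ∑-cong ts (λ s → cong₂ _*_ (D-shift t∈ (t′ ∙ s))
             (trans (cong D (trans (sym (∙-assoc t t′ s)) (trans (cong (_∙ s) (∙-comm t t′)) (∙-assoc t′ t s)))) (D-shift t′∈ (t ∙ s)))) ⟩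
      (∑[ s ∈ ts ] ((∑[ i ∈ is ] (ω (t · i) * N i (t′ ∙ s))) * (∑[ j ∈ is ] (ω (t′ · j) * N j (t ∙ s)))))
        ≡⟨ ∑-cong ts (λ s → trans (∑-*-∑ is is _ _) (∑-cong is λ i → ∑-cong is λ j →
             crossover (ω (t · i)) (N i (t′ ∙ s)) (ω (t′ · j)) (N j (t ∙ s)))) ⟩
      (∑[ s ∈ ts ] ∑[ i ∈ is ] ∑[ j ∈ is ] summand t t′ s i j) ∎
    regroup : ∀ s → (∑[ t ∈ ts ] ∑[ t′ ∈ ts ] ∑[ i ∈ is ] ∑[ j ∈ is ] summand t t′ s i j) ≡ (∑[ i ∈ is ] ∑[ j ∈ is ] (U s i j * U s j i))
    regroup s = begin-equality
      (∑[ t ∈ ts ] ∑[ t′ ∈ ts ] ∑[ i ∈ is ] ∑[ j ∈ is ] summand t t′ s i j)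
        ≡⟨ trans (∑-cong ts λ t → ∑-swap ts is _) (∑-swap ts is _) ⟩
      (∑[ i ∈ is ] ∑[ t ∈ ts ] ∑[ t′ ∈ ts ] ∑[ j ∈ is ] summand t t′ s i j)
        ≡⟨ ∑-cong is (λ i → trans (∑-cong ts λ t → ∑-swap ts is _) (∑-swap ts is _)) ⟩
      (∑[ i ∈ is ] ∑[ j ∈ is ] ∑[ t ∈ ts ] ∑[ t′ ∈ ts ] summand t t′ s i j)
        ≡⟨ ∑-cong is (λ i → ∑-cong is λ j → sym (∑-*-∑ ts ts _ _)) ⟩
      (∑[ i ∈ is ] ∑[ j ∈ is ] (U s i j * U s j i)) ∎

-- The finite field, its units, and the torus of pairs of units.

module Field (F : FiniteField) where

  open FiniteField F public using (0≢1)
    renaming (Carrier to K; _≟_ to infix 4 _≟_; _+_ to infixl 6 _+ᴷ_; _*_ to infixl 7 _*ᴷ_; -_ to infix 8 -ᴷ_; 0# to 0ᴷ; 1# to 1ᴷ; elements to Ks)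

  commutativeRing : CommutativeRing 0ℓ 0ℓ
  commutativeRing = record { isCommutativeRing = FiniteField.isCommutativeRing F }

  module K = CommutativeRing commutativeRing
  module KP = Algebra.Properties.Ring K.ring

  Ks! : Unique Ks
  Ks! = FiniteField.elements-unique F

  ∈Ks : ∀ a → a ∈ Ks
  ∈Ks = FiniteField.elements-complete F

  inv : ∀ {a} → a ≢ 0ᴷ → K
  inv a≢0 = proj₁ (FiniteField.inverse F _ a≢0)

  inv-invʳ : ∀ {a} (a≢0 : a ≢ 0ᴷ) → a *ᴷ inv a≢0 ≡ 1ᴷ
  inv-invʳ a≢0 = proj₂ (FiniteField.inverse F _ a≢0)

  inv-invˡ : ∀ {a} (a≢0 : a ≢ 0ᴷ) → inv a≢0 *ᴷ a ≡ 1ᴷ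
  inv-invˡ a≢0 = trans (K.*-comm _ _) (inv-invʳ a≢0)

  inv-cancelˡ : ∀ {a} (a≢0 : a ≢ 0ᴷ) b → inv a≢0 *ᴷ (a *ᴷ b) ≡ b
  inv-cancelˡ a≢0 b = trans (sym (K.*-assoc _ _ b)) (trans (cong (_*ᴷ b) (inv-invˡ a≢0)) (K.*-identityˡ b))

  inv-cancelʳ : ∀ {a} (a≢0 : a ≢ 0ᴷ) b → a *ᴷ (inv a≢0 *ᴷ b) ≡ b
  inv-cancelʳ a≢0 b = trans (sym (K.*-assoc _ _ b)) (trans (cong (_*ᴷ b) (inv-invʳ a≢0)) (K.*-identityˡ b))

  *-cancelˡ : ∀ {a b c} → a ≢ 0ᴷ → a *ᴷ b ≡ a *ᴷ c → b ≡ c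
  *-cancelˡ {b = b} {c} a≢0 e = trans (sym (inv-cancelˡ a≢0 b)) (trans (cong (inv a≢0 *ᴷ_) e) (inv-cancelˡ a≢0 c))

  *-cancelʳ : ∀ {a b c} → a ≢ 0ᴷ → b *ᴷ a ≡ c *ᴷ a → b ≡ c
  *-cancelʳ a≢0 e = *-cancelˡ a≢0 (trans (K.*-comm _ _) (trans e (K.*-comm _ _)))

  *≢0 : ∀ {a b} → a ≢ 0ᴷ → b ≢ 0ᴷ → a *ᴷ b ≢ 0ᴷ
  *≢0 a≢0 b≢0 e = b≢0 (*-cancelˡ a≢0 (trans e (sym (K.zeroʳ _))))

  inv≢0 : ∀ {a} (a≢0 : a ≢ 0ᴷ) → inv a≢0 ≢ 0ᴷ
  inv≢0 a≢0 e = 0≢1 (trans (sym (K.zeroʳ _)) (trans (cong (_ *ᴷ_) (sym e)) (inv-invʳ a≢0)))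

  -- The product of `a + b` and `a - b` vanishes, and a nonzero `a + b` cancels from it. In
  -- characteristic 2 the two alternatives coincide.
  square-eq⇒± : ∀ a b → a *ᴷ a ≡ b *ᴷ b → a ≡ b ⊎ a ≡ -ᴷ b
  square-eq⇒± a b e with (a +ᴷ b) ≟ 0ᴷ
  ... | yes s = inj₂ (KP.+-inverseˡ-unique a b s)
  ... | no ¬s = inj₁ (KP.x∙y⁻¹≈ε⇒x≈y a b (*-cancelˡ ¬s (trans factor (sym (K.zeroʳ _)))))
    where
    open ≡-Reasoning
    factor : (a +ᴷ b) *ᴷ (a +ᴷ -ᴷ b) ≡ 0ᴷ
    factor = begin
      (a +ᴷ b) *ᴷ (a +ᴷ -ᴷ b)
        ≡⟨ K.distribˡ (a +ᴷ b) a (-ᴷ b) ⟩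
      (a +ᴷ b) *ᴷ a +ᴷ (a +ᴷ b) *ᴷ -ᴷ b
        ≡⟨ cong₂ _+ᴷ_ (K.distribʳ a a b) (trans (sym (KP.-‿distribʳ-* (a +ᴷ b) b)) (cong -ᴷ_ (K.distribʳ b a b))) ⟩
      (a *ᴷ a +ᴷ b *ᴷ a) +ᴷ -ᴷ (a *ᴷ b +ᴷ b *ᴷ b)
        ≡⟨ cong (λ s → (a *ᴷ a +ᴷ b *ᴷ a) +ᴷ -ᴷ s)
             (trans (K.+-comm _ _) (cong₂ _+ᴷ_ (sym e) (K.*-comm a b))) ⟩
      (a *ᴷ a +ᴷ b *ᴷ a) +ᴷ -ᴷ (a *ᴷ a +ᴷ b *ᴷ a)
        ≡⟨ K.-‿inverseʳ _ ⟩
      0ᴷ ∎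

  nonzero? : ∀ a → Dec (a ≢ 0ᴷ)
  nonzero? a = ¬? (a ≟ 0ᴷ)

  Us : List K
  Us = filter nonzero? Ks

  Us! : Unique Us
  Us! = Unique.filter⁺ nonzero? Ks!

  ∈Us : ∀ {a} → a ≢ 0ᴷ → a ∈ Us
  ∈Us a≢0 = ∈-filter⁺ nonzero? (∈Ks _) a≢0

  Us≢0 : ∀ {a} → a ∈ Us → a ≢ 0ᴷ
  Us≢0 i = proj₂ (∈-filter⁻ nonzero? {xs = Ks} i)

  q n : ℤ
  q = card Ks
  n = card Us

  ∑-Us-* : ∀ {a} → a ∈ Us → ∀ f → (∑[ b ∈ Us ] f (a *ᴷ b)) ≡ ∑ Us f
  ∑-Us-* {a} i = ∑-reindex _≟_ (a *ᴷ_) (inv a≢0 *ᴷ_) Us!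
    (λ j → ∈Us (*≢0 a≢0 (Us≢0 j))) (λ j → ∈Us (*≢0 (inv≢0 a≢0) (Us≢0 j)))
    (λ {b} _ → inv-cancelʳ a≢0 b) (λ {b} _ → inv-cancelˡ a≢0 b)
    where a≢0 = Us≢0 i

  infix 4 _≟ᵀ_
  infixl 7 _∙_

  -- All pairs of field elements are allowed, which keeps `_∙_` total. The torus itself is the list
  -- `Ts`; membership in it is assumed wherever a coordinate has to be inverted.
  T : Set
  T = K × K

  Ts : List T
  Ts = cartesianProduct Us Us

  Ts! : Unique Ts
  Ts! = Unique.cartesianProduct⁺ Us! Us!

  _≟ᵀ_ : DecidableEquality T
  _≟ᵀ_ = Product.≡-dec _≟_ _≟_

  _∙_ : T → T → T
  (a , b) ∙ (c , d) = a *ᴷ c , b *ᴷ d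

  -ᵀ_ : T → T
  -ᵀ (a , b) = -ᴷ a , -ᴷ b

  ∙-assoc : ∀ s t u → (s ∙ t) ∙ u ≡ s ∙ (t ∙ u)
  ∙-assoc _ _ _ = cong₂ _,_ (K.*-assoc _ _ _) (K.*-assoc _ _ _)

  ∙-comm : ∀ s t → s ∙ t ≡ t ∙ s
  ∙-comm _ _ = cong₂ _,_ (K.*-comm _ _) (K.*-comm _ _)

  ∑-Ts-∙ : ∀ {t} → t ∈ Ts → ∀ f → (∑[ s ∈ Ts ] f (t ∙ s)) ≡ ∑ Ts f
  ∑-Ts-∙ {t₁ , t₂} i f = let i₁ , i₂ = ∈-cartesianProduct⁻ Us Us i in begin
    (∑[ s ∈ Ts ] f ((t₁ , t₂) ∙ s))                   ≡⟨ ∑-cartesianProduct Us Us _ ⟩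
    (∑[ a ∈ Us ] ∑[ b ∈ Us ] f (t₁ *ᴷ a , t₂ *ᴷ b))   ≡⟨ ∑-cong Us (λ a → ∑-Us-* i₂ (λ b → f (t₁ *ᴷ a , b))) ⟩
    (∑[ a ∈ Us ] ∑[ b ∈ Us ] f (t₁ *ᴷ a , b))         ≡⟨ ∑-Us-* i₁ (λ a → ∑[ b ∈ Us ] f (a , b)) ⟩
    (∑[ a ∈ Us ] ∑[ b ∈ Us ] f (a , b))               ≡⟨ sym (∑-cartesianProduct Us Us f) ⟩
    ∑ Ts f                                            ∎
    where open ≡-Reasoning

-- Vectors over the field and equidistribution.

module VectorSpace (F : FiniteField) (d : ℕ) where

  open Field F public

  V : Set
  V = Vect F d

  infix 4 _≟ⱽ_
  infixl 6 _∔_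
  infixr 7 _·_

  _∔_ : V → V → V
  _∔_ = _⊕_ F

  _·_ : ∀ {k} → K → Vec K k → Vec K k
  _·_ = _⊙_ F

  0ⱽ : ∀ {k} → Vec K k
  0ⱽ = zeroV F

  _≟ⱽ_ : DecidableEquality V
  _≟ⱽ_ = Vec.≡-dec _≟_

  vectors : ∀ k → List (Vec K k)
  vectors ℕ.zero    = [] ∷ []
  vectors (ℕ.suc k) = cartesianProductWith _∷_ Ks (vectors k)

  vectors! : ∀ k → Unique (vectors k)
  vectors! ℕ.zero    = [] ∷ []
  vectors! (ℕ.suc k) = Unique.cartesianProductWith⁺ _∷_ Vec.∷-injective Ks! (vectors! k)

  ∈vectors : ∀ {k} (v : Vec K k) → v ∈ vectors k
  ∈vectors []      = here refl
  ∈vectors (a ∷ v) = ∈-cartesianProductWith⁺ _∷_ (∈Ks a) (∈vectors v)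

  length-vectors : ∀ k → length (vectors k) ≡ FiniteField.order F ℕ.^ k
  length-vectors ℕ.zero    = refl
  length-vectors (ℕ.suc k) = trans (length-cartesianProductWith _∷_ Ks (vectors k))
    (cong (FiniteField.order F ℕ.*_) (length-vectors k))

  Xs : List V
  Xs = vectors d

  Xs! : Unique Xs
  Xs! = vectors! d

  ·-assoc : ∀ {k} a b (v : Vec K k) → a · (b · v) ≡ (a *ᴷ b) · v
  ·-assoc a b []      = refl
  ·-assoc a b (x ∷ v) = cong₂ _∷_ (sym (K.*-assoc a b x)) (·-assoc a b v)

  ·-identityˡ : ∀ {k} (v : Vec K k) → 1ᴷ · v ≡ v
  ·-identityˡ []      = refl
  ·-identityˡ (x ∷ v) = cong₂ _∷_ (K.*-identityˡ x) (·-identityˡ v)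

  ·-zeroˡ : ∀ {k} (v : Vec K k) → 0ᴷ · v ≡ 0ⱽ
  ·-zeroˡ []      = refl
  ·-zeroˡ (x ∷ v) = cong₂ _∷_ (K.zeroˡ x) (·-zeroˡ v)

  inv-·-cancelˡ : ∀ {a} (a≢0 : a ≢ 0ᴷ) (v : V) → inv a≢0 · (a · v) ≡ v
  inv-·-cancelˡ a≢0 v = trans (·-assoc _ _ v) (trans (cong (_· v) (inv-invˡ a≢0)) (·-identityˡ v))

  inv-·-cancelʳ : ∀ {a} (a≢0 : a ≢ 0ᴷ) (v : V) → a · (inv a≢0 · v) ≡ v
  inv-·-cancelʳ a≢0 v = trans (·-assoc _ _ v) (trans (cong (_· v) (inv-invʳ a≢0)) (·-identityˡ v))

  ·-cancelˡ : ∀ {a} {v w : V} → a ≢ 0ᴷ → a · v ≡ a · w → v ≡ w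
  ·-cancelˡ a≢0 e = trans (sym (inv-·-cancelˡ a≢0 _)) (trans (cong (inv a≢0 ·_) e) (inv-·-cancelˡ a≢0 _))

  ·-cancelʳ : ∀ {k a b} (v : Vec K k) → v ≢ 0ⱽ → a · v ≡ b · v → a ≡ b
  ·-cancelʳ []      v≢0 e = contradiction refl v≢0
  ·-cancelʳ (x ∷ v) v≢0 e with x ≟ 0ᴷ
  ... | no x≢0   = *-cancelʳ x≢0 (Vec.∷-injectiveˡ e)
  ... | yes refl = ·-cancelʳ v (v≢0 ∘ cong (0ᴷ ∷_)) (Vec.∷-injectiveʳ e)

  ∑-Xs-· : ∀ {a} → a ∈ Us → ∀ f → (∑[ x ∈ Xs ] f (a · x)) ≡ ∑ Xs f
  ∑-Xs-· {a} i = ∑-reindex _≟ⱽ_ (a ·_) (inv a≢0 ·_) Xs! (λ _ → ∈vectors _) (λ _ → ∈vectors _)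
    (λ {x} _ → inv-·-cancelʳ a≢0 x) (λ {x} _ → inv-·-cancelˡ a≢0 x)
    where a≢0 = Us≢0 i

  ∔-·-cancel : ∀ {k} a (x v : Vec K k) → _⊕_ F (_⊕_ F x (a · v)) ((-ᴷ a) · v) ≡ x
  ∔-·-cancel a []      []      = refl
  ∔-·-cancel a (x ∷ xs) (v ∷ vs) = cong₂ _∷_
    (trans (K.+-assoc x _ _) (trans (cong (x +ᴷ_)
      (trans (sym (K.distribʳ v a (-ᴷ a))) (trans (cong (_*ᴷ v) (K.-‿inverseʳ a)) (K.zeroˡ v)))) (K.+-identityʳ x)))
    (∔-·-cancel a xs vs)

  ∑-Xs-∔ : ∀ a v f → (∑[ x ∈ Xs ] f (x ∔ a · v)) ≡ ∑ Xs f
  ∑-Xs-∔ a v = ∑-reindex _≟ⱽ_ (_∔ a · v) (_∔ (-ᴷ a) · v) Xs! (λ _ → ∈vectors _) (λ _ → ∈vectors _)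
    (λ {x} _ → subst (λ b → (x ∔ (-ᴷ a) · v) ∔ b · v ≡ x) (KP.-‿involutive a) (∔-·-cancel (-ᴷ a) x v))
    (λ {x} _ → ∔-·-cancel a x v)

  -- Translation by `b - c` times `v` carries the fibre of `g` over `c` onto the fibre over `b` and
  -- preserves `w`. Hence all `q` fibres have the same weight, and together they exhaust `Xs`.
  equidistribution : (w : V → ℤ) (g : V → K) (v : V) →
    (∀ x a → g (x ∔ a · v) ≡ g x +ᴷ a) → (∀ x a → w (x ∔ a · v) ≡ w x) →
    ∀ c → q * (∑[ x ∈ Xs ] (w x * ⟦ g x ≟ c ⟧)) ≡ ∑ Xs w
  equidistribution w g v g-shift w-shift c = sym (begin
    ∑ Xs w
      ≡⟨ ∑-cong Xs (λ x → trans (sym (*-identityʳ (w x))) (trans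
           (cong (w x *_) (sym (trans (∑-cong Ks λ b → ⟦⟧-cong (g x ≟ b) (b ≟ g x) sym sym) (∑-⟦⟧-unique _≟_ Ks! (∈Ks (g x))))))
           (sym (∑-*ˡ Ks (w x) _)))) ⟩
    (∑[ x ∈ Xs ] ∑[ b ∈ Ks ] (w x * ⟦ g x ≟ b ⟧))
      ≡⟨ ∑-swap Xs Ks _ ⟩
    (∑[ b ∈ Ks ] ∑[ x ∈ Xs ] (w x * ⟦ g x ≟ b ⟧))
      ≡⟨ ∑-cong Ks fibres ⟩
    (∑[ b ∈ Ks ] ∑[ x ∈ Xs ] (w x * ⟦ g x ≟ c ⟧))
      ≡⟨ ∑-const Ks _ ⟩
    q * (∑[ x ∈ Xs ] (w x * ⟦ g x ≟ c ⟧)) ∎)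
    where
    open ≡-Reasoning
    shift-eq : ∀ b x → g x +ᴷ (b +ᴷ -ᴷ c) ≡ b → g x ≡ c
    shift-eq b x e = KP.x∙y⁻¹≈ε⇒x≈y (g x) c (KP.+-cancelʳ b _ _ (trans (trans (K.+-assoc _ _ _) (cong (g x +ᴷ_) (K.+-comm _ b))) (trans e (sym (K.+-identityˡ b)))))
    shift-eq⁻¹ : ∀ b x → g x ≡ c → g x +ᴷ (b +ᴷ -ᴷ c) ≡ b
    shift-eq⁻¹ b x refl = trans (sym (K.+-assoc _ _ _)) (KP.xyx⁻¹≈y (g x) b)
    fibres : ∀ b → (∑[ x ∈ Xs ] (w x * ⟦ g x ≟ b ⟧)) ≡ (∑[ x ∈ Xs ] (w x * ⟦ g x ≟ c ⟧))
    fibres b = trans (sym (∑-Xs-∔ (b +ᴷ -ᴷ c) v _)) (∑-cong Xs λ x → cong₂ _*_ (w-shift x _)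
      (⟦⟧-cong (g (x ∔ (b +ᴷ -ᴷ c) · v) ≟ b) (g x ≟ c)
        (λ e → shift-eq b x (trans (sym (g-shift x _)) e))
        (λ e → trans (g-shift x _) (shift-eq⁻¹ b x e))))

-- One and two linear conditions through a nondegenerate pairing.

module Pairing (F : FiniteField) (d : ℕ) (β : Vect F d → Vect F d → FiniteField.Carrier F) (bilinear : IsBilinear F d β)
  (nondegenerate : ∀ y → (∀ x → β x y ≡ FiniteField.0# F) → y ≡ zeroV F)
  where

  open VectorSpace F d

  +ˡ : ∀ x x′ y → β (x ∔ x′) y ≡ β x y +ᴷ β x′ y
  +ˡ = proj₁ bilinear

  ·ˡ : ∀ a x y → β (a · x) y ≡ a *ᴷ β x y
  ·ˡ = proj₁ (proj₂ bilinear)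

  +ʳ : ∀ x y y′ → β x (y ∔ y′) ≡ β x y +ᴷ β x y′
  +ʳ = proj₁ (proj₂ (proj₂ bilinear))

  ·ʳ : ∀ a x y → β x (a · y) ≡ a *ᴷ β x y
  ·ʳ = proj₂ (proj₂ (proj₂ bilinear))

  -- Nondegeneracy excludes that all `β x y` vanish; since `Xs` is finite, a search finds a nonzero
  -- one, and `x` is rescaled.
  dual : ∀ {y} → y ≢ 0ⱽ → ∃[ v ] β v y ≡ 1ᴷ
  dual {y} y≢0 with any? (λ x → nonzero? (β x y)) Xs
  ... | yes p = let x , βxy≢0 = satisfied p in
    inv βxy≢0 · x , trans (·ˡ _ x y) (inv-invˡ βxy≢0)
  ... | no ¬p = contradiction (nondegenerate y λ x → decidable-stable (β x y ≟ 0ᴷ) λ βxy≢0 → ¬p (lose (∈vectors x) βxy≢0)) y≢0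

  -- A Gram-Schmidt step. With `v₀` dual to `y′`, the vector `y - a · y′` for `a = β v₀ y` is
  -- nonzero, hence has a dual `w`; subtracting from `w` its component along `v₀` annihilates `y′`.
  separating : ∀ {y y′} → y′ ≢ 0ⱽ → (∀ a → y ≢ a · y′) → ∃[ v ] (β v y ≡ 1ᴷ × β v y′ ≡ 0ᴷ)
  separating {y} {y′} y′≢0 y≢ay′ = v , βvy≡1 , βvy′≡0
    where
    open ≡-Reasoning
    v₀ w v : V
    v₀ = proj₁ (dual y′≢0)
    βv₀y′≡1 : β v₀ y′ ≡ 1ᴷ
    βv₀y′≡1 = proj₂ (dual y′≢0)
    a : K
    a = β v₀ y
    y₁≢0 : y ∔ (-ᴷ a) · y′ ≢ 0ⱽ
    y₁≢0 e = y≢ay′ a (trans (sym (∔-·-cancel (-ᴷ a) y y′))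
      (trans (cong₂ _∔_ e (cong (_· y′) (KP.-‿involutive a))) (Vec.zipWith-identityˡ K.+-identityˡ (a · y′))))
    w = proj₁ (dual y₁≢0)
    b : K
    b = β w y′
    v = w ∔ (-ᴷ b) · v₀
    βvy′≡0 : β v y′ ≡ 0ᴷ
    βvy′≡0 = begin
      β v y′                     ≡⟨ trans (+ˡ w _ y′) (cong (b +ᴷ_) (·ˡ (-ᴷ b) v₀ y′)) ⟩
      b +ᴷ -ᴷ b *ᴷ β v₀ y′       ≡⟨ cong (λ c → b +ᴷ -ᴷ b *ᴷ c) βv₀y′≡1 ⟩
      b +ᴷ -ᴷ b *ᴷ 1ᴷ            ≡⟨ cong (b +ᴷ_) (K.*-identityʳ (-ᴷ b)) ⟩
      b +ᴷ -ᴷ b                  ≡⟨ K.-‿inverseʳ b ⟩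
      0ᴷ                         ∎
    βvy≡1 : β v y ≡ 1ᴷ
    βvy≡1 = begin
      β v y                          ≡⟨ trans (+ˡ w _ y) (cong (β w y +ᴷ_) (·ˡ (-ᴷ b) v₀ y)) ⟩
      -- The correction `b a` can also be read as `a` times `β w y′`, which turns the expression
      -- into `w` paired with `y - a · y′`.
      β w y +ᴷ -ᴷ b *ᴷ a             ≡⟨ cong (β w y +ᴷ_) (trans (sym (KP.-‿distribˡ-* b a)) (trans (cong -ᴷ_ (K.*-comm b a)) (KP.-‿distribˡ-* a b))) ⟩
      β w y +ᴷ -ᴷ a *ᴷ β w y′        ≡⟨ sym (trans (+ʳ w y _) (cong (β w y +ᴷ_) (·ʳ (-ᴷ a) w y′))) ⟩
      β w (y ∔ (-ᴷ a) · y′)          ≡⟨ proj₂ (dual y₁≢0) ⟩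
      1ᴷ                             ∎

  β-shift : ∀ {y v} → β v y ≡ 1ᴷ → ∀ x a → β (x ∔ a · v) y ≡ β x y +ᴷ a
  β-shift {y} {v} e x a = trans (+ˡ x _ y) (cong (β x y +ᴷ_) (trans (·ˡ a v y) (trans (cong (a *ᴷ_) e) (K.*-identityʳ a))))

  β-fixed : ∀ {y v} → β v y ≡ 0ᴷ → ∀ x a → β (x ∔ a · v) y ≡ β x y
  β-fixed {y} {v} e x a = trans (+ˡ x _ y) (trans (cong (β x y +ᴷ_) (trans (·ˡ a v y) (trans (cong (a *ᴷ_) e) (K.zeroʳ a)))) (K.+-identityʳ _))

  fibre₁ : ∀ {y} → y ≢ 0ⱽ → ∀ c → (∑[ x ∈ Xs ] (q * ⟦ β x y ≟ c ⟧)) ≡ card Xs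
  fibre₁ {y} y≢0 c = let v , e = dual y≢0 in
    trans (trans (∑-*ˡ Xs q _) (cong (q *_) (∑-cong Xs λ x → sym (*-identityˡ ⟦ β x y ≟ c ⟧))))
      (equidistribution (λ _ → 1ℤ) (λ x → β x y) v (β-shift e) (λ _ _ → refl) c)

  -- Pairwise independence: moving along a separating vector shifts `β x y` and fixes `β x y′`, so
  -- the condition on `y′` can serve as the invariant weight in `equidistribution`.
  fibre₂ : ∀ {y y′} → y′ ≢ 0ⱽ → (∀ a → y ≢ a · y′) → ∀ c c′ →
    (∑[ x ∈ Xs ] ((q * ⟦ β x y ≟ c ⟧) * (q * ⟦ β x y′ ≟ c′ ⟧))) ≡ card Xs
  fibre₂ {y} {y′} y′≢0 y≢ay′ c c′ = let v , e , e′ = separating y′≢0 y≢ay′ in begin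
    (∑[ x ∈ Xs ] ((q * ⟦ β x y ≟ c ⟧) * (q * ⟦ β x y′ ≟ c′ ⟧)))
      ≡⟨ ∑-cong Xs (λ x → reorder q ⟦ β x y ≟ c ⟧ (q * ⟦ β x y′ ≟ c′ ⟧)) ⟩
    (∑[ x ∈ Xs ] (q * ((q * ⟦ β x y′ ≟ c′ ⟧) * ⟦ β x y ≟ c ⟧)))
      ≡⟨ ∑-*ˡ Xs q _ ⟩
    q * (∑[ x ∈ Xs ] ((q * ⟦ β x y′ ≟ c′ ⟧) * ⟦ β x y ≟ c ⟧))
      ≡⟨ equidistribution (λ x → q * ⟦ β x y′ ≟ c′ ⟧) (λ x → β x y) v (β-shift e)
           (λ x a → cong (λ b → q * ⟦ b ≟ c′ ⟧) (β-fixed e′ x a)) c ⟩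
    (∑[ x ∈ Xs ] (q * ⟦ β x y′ ≟ c′ ⟧))
      ≡⟨ fibre₁ y′≢0 c′ ⟩
    card Xs ∎
    where
    open ≡-Reasoning
    reorder : ∀ a b c → (a * b) * c ≡ a * (c * b)
    reorder = solve-∀

  Ps : List (V × K)
  Ps = cartesianProduct Xs Us

  -- One factor of `φ` at a target dilated by `α`. The factor `q` gives it mean 1 over `Ps` when `y`
  -- is nonzero, so no division is ever needed.
  h : K → V → V × K → ℤ
  h α y (x , a) = q * ⟦ β x y ≟ α *ᴷ a ⟧

  q≥0 : 0ℤ ≤ q
  q≥0 = card-nonNeg Ks

  h-nonNeg : ∀ α y p → 0ℤ ≤ h α y p
  h-nonNeg α y (x , a) = *-nonNeg q≥0 (⟦⟧-nonNeg (β x y ≟ α *ᴷ a))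

  h≤q : ∀ α y p → h α y p ≤ q
  h≤q α y (x , a) = ≤-trans (*-monoˡ q≥0 (⟦⟧≤1 (β x y ≟ α *ᴷ a))) (≤-reflexive (*-identityʳ q))

  ∑-Ps : ∀ (f : V × K → ℤ) → (∀ a → (∑[ x ∈ Xs ] f (x , a)) ≡ card Xs) → ∑ Ps f ≡ card Ps
  ∑-Ps f e = trans (trans (∑-cartesianProduct Xs Us f) (∑-swap Xs Us _))
    (trans (∑-cong Us e) (trans (∑-const Us (card Xs)) (trans (*-comm n (card Xs)) (sym (card-cartesianProduct Xs Us)))))

  ∑h : ∀ α {y} → y ≢ 0ⱽ → ∑ Ps (h α y) ≡ card Ps
  ∑h α {y} y≢0 = ∑-Ps (h α y) λ a → fibre₁ y≢0 (α *ᴷ a)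

  ∑hh : ∀ α α′ {y y′} → y′ ≢ 0ⱽ → (∀ a → y ≢ a · y′) → (∑[ p ∈ Ps ] (h α y p * h α′ y′ p)) ≡ card Ps
  ∑hh α α′ {y} {y′} y′≢0 y≢ay′ = ∑-Ps (λ p → h α y p * h α′ y′ p) λ a → fibre₂ y′≢0 y≢ay′ (α *ᴷ a) (α′ *ᴷ a)

  ∑hh≤ : ∀ α α′ {y} y′ → y ≢ 0ⱽ → (∑[ p ∈ Ps ] (h α y p * h α′ y′ p)) ≤ q * card Ps
  ∑hh≤ α α′ {y} y′ y≢0 = begin
    (∑[ p ∈ Ps ] (h α y p * h α′ y′ p)) ≤⟨ ∑-mono Ps (λ p → *-monoˡ (h-nonNeg α y p) (h≤q α′ y′ p)) ⟩
    (∑[ p ∈ Ps ] (h α y p * q))         ≡⟨ ∑-*ʳ Ps q _ ⟩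
    ∑ Ps (h α y) * q                    ≡⟨ trans (cong (_* q) (∑h α y≢0)) (*-comm (card Ps) q) ⟩
    q * card Ps                         ∎
    where open ≤-Reasoning

  ∑hh-nonNeg : ∀ α α′ y y′ → 0ℤ ≤ (∑[ p ∈ Ps ] (h α y p * h α′ y′ p))
  ∑hh-nonNeg α α′ y y′ = ∑-nonNeg Ps λ p → *-nonNeg (h-nonNeg α y p) (h-nonNeg α′ y′ p)

  -- If both indicators are 1 at `(x , a)`, then `α a` equals `c α′ a`, and the unit `a` cancels.
  ∑hh-mismatch : ∀ α α′ c y → α ≢ c *ᴷ α′ → (∑[ p ∈ Ps ] (h α (c · y) p * h α′ y p)) ≡ 0ℤ
  ∑hh-mismatch α α′ c y α≢cα′ = trans (∑-cong-∈ Ps vanish) (∑-0 Ps)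
    where
    vanish : ∀ {p} → p ∈ Ps → h α (c · y) p * h α′ y p ≡ 0ℤ
    vanish {x , a} i with β x y ≟ α′ *ᴷ a
    ... | no _  = trans (cong (h α (c · y) (x , a) *_) (*-zeroʳ q)) (*-zeroʳ (h α (c · y) (x , a)))
    ... | yes e = cong (_* (q * 1ℤ)) (trans (cong (q *_) (⟦⟧-false (β x (c · y) ≟ α *ᴷ a) λ e′ →
      α≢cα′ (*-cancelʳ (Us≢0 (proj₂ (∈-cartesianProduct⁻ Xs Us i)))
        (trans (sym e′) (trans (·ʳ c x y) (trans (cong (c *ᴷ_) e) (sym (K.*-assoc c α′ a)))))))) (*-zeroʳ q))

-- A covariance expansion: after multiplying out, each double sum splits into a sum over `ps` times
-- a sum over `rs`.
∑∑-product-deviation : ∀ {P R : Set} (ps : List P) (rs : List R) (f f′ : P → ℤ) (g g′ : R → ℤ) →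
  (∑[ p ∈ ps ] ∑[ r ∈ rs ] ((f p * g r - 1ℤ) * (f′ p * g′ r - 1ℤ)))
  ≡ (((∑[ p ∈ ps ] (f p * f′ p)) * (∑[ r ∈ rs ] (g r * g′ r)) + card ps * card rs) - ∑ ps f * ∑ rs g) - ∑ ps f′ * ∑ rs g′
∑∑-product-deviation ps rs f f′ g g′ = begin
  (∑[ p ∈ ps ] ∑[ r ∈ rs ] ((f p * g r - 1ℤ) * (f′ p * g′ r - 1ℤ)))
    ≡⟨ ∑-cong ps (λ p → trans (∑-cong rs λ r → expand (f p) (f′ p) (g r) (g′ r))
         (trans (∑-- rs (λ r → (f p * f′ p) * (g r * g′ r) + 1ℤ * 1ℤ - f p * g r) (λ r → f′ p * g′ r))
           (cong (_- _) (trans (∑-- rs (λ r → (f p * f′ p) * (g r * g′ r) + 1ℤ * 1ℤ) (λ r → f p * g r))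
             (cong (_- _) (∑-+ rs (λ r → (f p * f′ p) * (g r * g′ r)) (λ _ → 1ℤ * 1ℤ))))))) ⟩
  (∑[ p ∈ ps ] ((∑[ r ∈ rs ] ((f p * f′ p) * (g r * g′ r)) + (∑[ r ∈ rs ] (1ℤ * 1ℤ))
    - (∑[ r ∈ rs ] (f p * g r))) - (∑[ r ∈ rs ] (f′ p * g′ r))))
    ≡⟨ trans (∑-- ps _ _) (cong₂ _-_ (trans (∑-- ps _ _) (cong₂ _-_ (∑-+ ps _ _) refl)) refl) ⟩
  (((∑[ p ∈ ps ] ∑[ r ∈ rs ] ((f p * f′ p) * (g r * g′ r))) + (∑[ p ∈ ps ] ∑[ r ∈ rs ] (1ℤ * 1ℤ)))
    - (∑[ p ∈ ps ] ∑[ r ∈ rs ] (f p * g r))) - (∑[ p ∈ ps ] ∑[ r ∈ rs ] (f′ p * g′ r))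
    ≡⟨ sym (cong₂ _-_ (cong₂ _-_ (cong₂ _+_ (∑-*-∑ ps rs _ _) (∑-*-∑ ps rs _ _)) (∑-*-∑ ps rs f g)) (∑-*-∑ ps rs f′ g′)) ⟩
  (((∑[ p ∈ ps ] (f p * f′ p)) * (∑[ r ∈ rs ] (g r * g′ r)) + card ps * card rs) - ∑ ps f * ∑ rs g) - ∑ ps f′ * ∑ rs g′ ∎
  where
  open ≡-Reasoning
  -- The constant is kept as `1ℤ * 1ℤ` so that its double sum also splits, into `card ps * card rs`.
  expand : ∀ a b s t → (a * s - 1ℤ) * (b * t - 1ℤ) ≡ (((a * b) * (s * t) + 1ℤ * 1ℤ) - a * s) - b * t
  expand = solve-∀

-- Correlation of the deviations attached to two vectors.

module Form (F : FiniteField) (d : ℕ) (B : Vect F d → Vect F d → FiniteField.Carrier F)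
  (bilinear : IsBilinear F d B) (nondegenerate : IsNonDegenerate F d B) where

  open VectorSpace F d

  -- In `B y z` the right argument is the one that varies for fixed `y`, so `Pairing` is also
  -- instantiated at the transposed form.
  bilinearᵀ : IsBilinear F d (λ z y → B y z)
  bilinearᵀ = let +ˡ , ·ˡ , +ʳ , ·ʳ = bilinear in
    (λ z z′ y → +ʳ y z z′) , (λ a z y → ·ʳ a y z) , (λ z y y′ → +ˡ y y′ z) , (λ a z y → ·ˡ a y z)

  module L = Pairing F d B bilinear (proj₂ nondegenerate)
  module R = Pairing F d (λ z y → B y z) bilinearᵀ (proj₁ nondegenerate)

  I : Set
  I = V × V

  Is : List I
  Is = cartesianProduct Xs Xs

  infixr 7 _⋆_

  _⋆_ : T → I → I
  (α , γ) ⋆ (x , z) = α · x , γ · z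

  ∑-Is-⋆ : ∀ {t} → t ∈ Ts → ∀ f → (∑[ i ∈ Is ] f (t ⋆ i)) ≡ ∑ Is f
  ∑-Is-⋆ {α , γ} t∈ f = let α∈ , γ∈ = ∈-cartesianProduct⁻ Us Us t∈ in begin
    (∑[ i ∈ Is ] f ((α , γ) ⋆ i))                  ≡⟨ ∑-cartesianProduct Xs Xs _ ⟩
    (∑[ x ∈ Xs ] ∑[ z ∈ Xs ] f (α · x , γ · z))    ≡⟨ ∑-cong Xs (λ x → ∑-Xs-· γ∈ (λ z → f (α · x , z))) ⟩
    (∑[ x ∈ Xs ] ∑[ z ∈ Xs ] f (α · x , z))        ≡⟨ ∑-Xs-· α∈ (λ x → ∑[ z ∈ Xs ] f (x , z)) ⟩
    (∑[ x ∈ Xs ] ∑[ z ∈ Xs ] f (x , z))            ≡⟨ sym (∑-cartesianProduct Xs Xs f) ⟩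
    ∑ Is f                                         ∎
    where open ≡-Reasoning

  -- For fixed `y`, the joint condition on `x` and `z`, scaled by `q²` to expectation 1 and then
  -- centred.
  φ : V → I → T → ℤ
  φ y (x , z) (a , b) = (q * ⟦ B x y ≟ a ⟧) * (q * ⟦ B y z ≟ b ⟧) - 1ℤ

  -- By bilinearity, dilating a vector and its target value by the same unit leaves the condition
  -- unchanged. Summed over `y`, this is the equivariance that `GroupAction` asks for.
  φ-equivariant : ∀ y {t} → t ∈ Ts → ∀ i s → φ y (t ⋆ i) (t ∙ s) ≡ φ y i s
  φ-equivariant y {α , γ} t∈ (x , z) (a , b) = cong₂ (λ u v → (q * u) * (q * v) - 1ℤ)
    (⟦⟧-cong (B (α · x) y ≟ α *ᴷ a) (B x y ≟ a)
      (λ e → *-cancelˡ (Us≢0 α∈) (trans (sym (L.·ˡ α x y)) e)) (λ e → trans (L.·ˡ α x y) (cong (α *ᴷ_) e)))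
    (⟦⟧-cong (B y (γ · z) ≟ γ *ᴷ b) (B y z ≟ b)
      (λ e → *-cancelˡ (Us≢0 γ∈) (trans (sym (L.·ʳ γ y z)) e)) (λ e → trans (L.·ʳ γ y z) (cong (γ *ᴷ_) e)))
    where
    α∈ = proj₁ (∈-cartesianProduct⁻ Us Us t∈)
    γ∈ = proj₂ (∈-cartesianProduct⁻ Us Us t∈)

  M : ℤ
  M = card L.Ps

  M≥0 : 0ℤ ≤ M
  M≥0 = card-nonNeg L.Ps

  qM≥0 : 0ℤ ≤ q * M
  qM≥0 = *-nonNeg L.q≥0 M≥0

  -- For torus elements this says that `y` is `α / α′` times `y′` and also `γ / γ′` times `y′`, with
  -- denominators cleared.
  match : T → T → V → V → ℤ
  match (α , γ) (α′ , γ′) y y′ = ⟦ α′ · y ≟ⱽ α · y′ ⟧ * ⟦ γ′ · y ≟ⱽ γ · y′ ⟧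

  match-nonNeg : ∀ t t′ y y′ → 0ℤ ≤ match t t′ y y′
  match-nonNeg (α , γ) (α′ , γ′) y y′ = *-nonNeg (⟦⟧-nonNeg (α′ · y ≟ⱽ α · y′)) (⟦⟧-nonNeg (γ′ · y ≟ⱽ γ · y′))

  correlation : T → T → V → V → ℤ
  correlation t t′ y y′ = ∑[ s ∈ Ts ] ∑[ j ∈ Is ] (φ y j (t ∙ s) * φ y′ j (t′ ∙ s))

  -- Regroup the summation variables as `(x , a)` and `(z , b)`. The sum is then a covariance over a
  -- product of two copies of `Ps`, in which every single factor has total `M`.
  correlation≡ : ∀ α γ α′ γ′ {y y′} → y ≢ 0ⱽ → y′ ≢ 0ⱽ → correlation (α , γ) (α′ , γ′) y y′ ≡
    (∑[ p ∈ L.Ps ] (L.h α y p * L.h α′ y′ p)) * (∑[ r ∈ R.Ps ] (R.h γ y r * R.h γ′ y′ r)) - M * M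
  correlation≡ α γ α′ γ′ {y} {y′} y≢0 y′≢0 = begin
    (∑[ s ∈ Ts ] ∑[ j ∈ Is ] (φ y j ((α , γ) ∙ s) * φ y′ j ((α′ , γ′) ∙ s)))
      ≡⟨ trans (∑-cartesianProduct Us Us _) (∑-cong Us λ a → ∑-cong Us λ b → ∑-cartesianProduct Xs Xs _) ⟩
    (∑[ a ∈ Us ] ∑[ b ∈ Us ] ∑[ x ∈ Xs ] ∑[ z ∈ Xs ] f (x , a) (z , b))
      ≡⟨ trans (∑-cong Us λ a → ∑-swap Us Xs _) (∑-swap Us Xs _) ⟩
    (∑[ x ∈ Xs ] ∑[ a ∈ Us ] ∑[ b ∈ Us ] ∑[ z ∈ Xs ] f (x , a) (z , b))
      ≡⟨ ∑-cong Xs (λ x → ∑-cong Us λ a → trans (∑-swap Us Xs _) (sym (∑-cartesianProduct Xs Us (f (x , a))))) ⟩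
    (∑[ x ∈ Xs ] ∑[ a ∈ Us ] ∑[ r ∈ R.Ps ] f (x , a) r)
      ≡⟨ sym (∑-cartesianProduct Xs Us _) ⟩
    (∑[ p ∈ L.Ps ] ∑[ r ∈ R.Ps ] f p r)
      ≡⟨ ∑∑-product-deviation L.Ps R.Ps (L.h α y) (L.h α′ y′) (R.h γ y) (R.h γ′ y′) ⟩
    ((A * C + M * M) - ∑ L.Ps (L.h α y) * ∑ R.Ps (R.h γ y)) - ∑ L.Ps (L.h α′ y′) * ∑ R.Ps (R.h γ′ y′)
      ≡⟨ cong₂ (λ u v → ((A * C + M * M) - u) - v)
           (cong₂ _*_ (L.∑h α y≢0) (R.∑h γ y≢0)) (cong₂ _*_ (L.∑h α′ y′≢0) (R.∑h γ′ y′≢0)) ⟩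
    ((A * C + M * M) - M * M) - M * M
      ≡⟨ i+j-j-j≡i-j (A * C) (M * M) ⟩
    A * C - M * M ∎
    where
    open ≡-Reasoning
    A C : ℤ
    A = ∑[ p ∈ L.Ps ] (L.h α y p * L.h α′ y′ p)
    C = ∑[ r ∈ R.Ps ] (R.h γ y r * R.h γ′ y′ r)
    f : V × K → V × K → ℤ
    f p r = (L.h α y p * R.h γ y r - 1ℤ) * (L.h α′ y′ p * R.h γ′ y′ r - 1ℤ)

  unmatched : ∀ α γ α′ γ′ {y y′} → y ≢ 0ⱽ → y′ ≢ 0ⱽ →
    (∑[ p ∈ L.Ps ] (L.h α y p * L.h α′ y′ p)) * (∑[ r ∈ R.Ps ] (R.h γ y r * R.h γ′ y′ r)) ≡ 0ℤ →
    correlation (α , γ) (α′ , γ′) y y′ ≤ ((q * M) * (q * M)) * match (α , γ) (α′ , γ′) y y′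
  unmatched α γ α′ γ′ {y} {y′} y≢0 y′≢0 AC≡0 = begin
    correlation (α , γ) (α′ , γ′) y y′ ≡⟨ trans (correlation≡ α γ α′ γ′ y≢0 y′≢0) (cong (_- M * M) AC≡0) ⟩
    0ℤ - M * M                         ≡⟨ +-identityˡ (- (M * M)) ⟩
    - (M * M)                          ≤⟨ neg-mono-≤ (square-nonNeg M) ⟩
    0ℤ                                 ≤⟨ *-nonNeg (*-nonNeg qM≥0 qM≥0) (match-nonNeg (α , γ) (α′ , γ′) y y′) ⟩
    _                                  ∎
    where open ≤-Reasoning

  -- For vectors that are not proportional, independence on both sides gives exactly
  -- `M * M - M * M`. For `y = c · y′`, a dilation ratio other than `c` in either coordinate
  -- destroys all overlap.
  correlation≤ : ∀ t t′ {y y′} → y ≢ 0ⱽ → y′ ≢ 0ⱽ →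
    correlation t t′ y y′ ≤ ((q * M) * (q * M)) * match t t′ y y′
  correlation≤ (α , γ) (α′ , γ′) {y} {y′} y≢0 y′≢0 with any? (λ c → y ≟ⱽ c · y′) Ks
  ... | no ¬p = begin
    correlation (α , γ) (α′ , γ′) y y′ ≡⟨ correlation≡ α γ α′ γ′ y≢0 y′≢0 ⟩
    _                                  ≡⟨ cong (_- M * M) (cong₂ _*_ (L.∑hh α α′ y′≢0 indep) (R.∑hh γ γ′ y′≢0 indep)) ⟩
    M * M - M * M                      ≡⟨ +-inverseʳ (M * M) ⟩
    0ℤ                                 ≤⟨ *-nonNeg (*-nonNeg qM≥0 qM≥0) (match-nonNeg (α , γ) (α′ , γ′) y y′) ⟩
    _                                  ∎
    where
    open ≤-Reasoning
    indep : ∀ c → y ≢ c · y′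
    indep c e = ¬p (lose (∈Ks c) e)
  ... | yes p with satisfied p
  ... | c , refl with α ≟ c *ᴷ α′ | γ ≟ c *ᴷ γ′
  -- Both ratios equal `c`: the only case with a positive contribution, bounded trivially by `q * M`
  -- on each side.
  ... | yes refl | yes refl = begin
    correlation (c *ᴷ α′ , c *ᴷ γ′) (α′ , γ′) y y′ ≡⟨ correlation≡ (c *ᴷ α′) (c *ᴷ γ′) α′ γ′ y≢0 y′≢0 ⟩
    A * C - M * M                                  ≤⟨ i-k≤i (square-nonNeg M) ⟩
    A * C                                          ≤⟨ *-mono (L.∑hh-nonNeg (c *ᴷ α′) α′ y y′) qM≥0
                                                        (L.∑hh≤ (c *ᴷ α′) α′ y′ y≢0) (R.∑hh≤ (c *ᴷ γ′) γ′ y′ y≢0) ⟩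
    (q * M) * (q * M)                              ≡⟨ sym (trans (cong (((q * M) * (q * M)) *_) matched) (*-identityʳ _)) ⟩
    _                                              ∎
    where
    open ≤-Reasoning
    A C : ℤ
    A = ∑[ p ∈ L.Ps ] (L.h (c *ᴷ α′) y p * L.h α′ y′ p)
    C = ∑[ r ∈ R.Ps ] (R.h (c *ᴷ γ′) y r * R.h γ′ y′ r)
    same : ∀ δ → δ · (c · y′) ≡ (c *ᴷ δ) · y′
    same δ = trans (·-assoc δ c y′) (cong (_· y′) (K.*-comm δ c))
    matched : match (c *ᴷ α′ , c *ᴷ γ′) (α′ , γ′) y y′ ≡ 1ℤ
    matched = cong₂ _*_ (⟦⟧-true (α′ · y ≟ⱽ (c *ᴷ α′) · y′) (same α′)) (⟦⟧-true (γ′ · y ≟ⱽ (c *ᴷ γ′) · y′) (same γ′))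
  ... | no α≢ | _ = unmatched α γ α′ γ′ y≢0 y′≢0 (trans (cong (_* C) (L.∑hh-mismatch α α′ c y′ α≢)) (*-zeroˡ C))
    where C = ∑[ r ∈ R.Ps ] (R.h γ y r * R.h γ′ y′ r)
  ... | yes _ | no γ≢ = unmatched α γ α′ γ′ y≢0 y′≢0 (trans (cong (A *_) (R.∑hh-mismatch γ γ′ c y′ γ≢)) (*-zeroʳ A))
    where A = ∑[ p ∈ L.Ps ] (L.h α y p * L.h α′ y′ p)

-- The second moment of the deviation `D`.

module Energy (F : FiniteField) (d : ℕ) (B : Vect F d → Vect F d → FiniteField.Carrier F)
  (bilinear : IsBilinear F d B) (nondegenerate : IsNonDegenerate F d B)
  {S : Vect F d → Set} (S? : Decidable S) (0∉S : ¬ S (zeroV F))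
  where

  open VectorSpace F d
  open Form F d B bilinear nondegenerate

  e : V → ℤ
  e x = ⟦ S? x ⟧

  e-nonNeg : ∀ x → 0ℤ ≤ e x
  e-nonNeg x = ⟦⟧-nonNeg (S? x)

  e≤1 : ∀ x → e x ≤ 1ℤ
  e≤1 x = ⟦⟧≤1 (S? x)

  m : ℤ
  m = ∑ Xs e

  m≥0 : 0ℤ ≤ m
  m≥0 = ∑-nonNeg Xs e-nonNeg

  N : I → T → ℤ
  N i s = ∑[ y ∈ Xs ] (e y * φ y i s)

  ω : K → I → ℤ
  ω c (x , z) = (e x * e z) * ⟦ B z x ≟ c ⟧

  ω-nonNeg : ∀ c i → 0ℤ ≤ ω c i
  ω-nonNeg c (x , z) = *-nonNeg (*-nonNeg (e-nonNeg x) (e-nonNeg z)) (⟦⟧-nonNeg (B z x ≟ c))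

  ω≤1 : ∀ c i → ω c i ≤ 1ℤ
  ω≤1 c (x , z) = *-mono (*-nonNeg (e-nonNeg x) (e-nonNeg z)) (+≤+ ℕ.z≤n)
    (*-mono (e-nonNeg x) (+≤+ ℕ.z≤n) (e≤1 x) (e≤1 z)) (⟦⟧≤1 (B z x ≟ c))

  D : K → T → ℤ
  D c s = ∑[ i ∈ Is ] (ω c i * N i s)

  coincidences : T → T → ℤ
  coincidences t t′ = ∑[ y ∈ Xs ] ∑[ y′ ∈ Xs ] ((e y * e y′) * match t t′ y y′)

  -- Equidistribution holds only for nonzero vectors; this dichotomy restricts weighted sums to
  -- them.
  e-support : ∀ y → e y ≡ 0ℤ ⊎ y ≢ 0ⱽ
  e-support y with y ≟ⱽ 0ⱽ
  ... | yes refl = inj₁ (⟦⟧-false (S? 0ⱽ) 0∉S)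
  ... | no y≢0   = inj₂ y≢0

  -- Open both `N` as sums over `y` and `y′` and exchange sums: the inner sum over `s` and `j` is
  -- `correlation`, and the weight `e y * e y′` removes the zero vectors that `correlation≤`
  -- excludes.
  ∑NN≤ : ∀ t t′ → (∑[ s ∈ Ts ] ∑[ j ∈ Is ] (N j (t ∙ s) * N j (t′ ∙ s))) ≤ ((q * M) * (q * M)) * coincidences t t′
  ∑NN≤ t t′ = begin
    (∑[ s ∈ Ts ] ∑[ j ∈ Is ] (N j (t ∙ s) * N j (t′ ∙ s)))
      ≡⟨ ∑-cong Ts (λ s → ∑-cong Is λ j → trans (∑-*-∑ Xs Xs _ _) (∑-cong Xs λ y → ∑-cong Xs λ y′ →
           interchange (e y) (φ y j (t ∙ s)) (e y′) (φ y′ j (t′ ∙ s)))) ⟩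
    (∑[ s ∈ Ts ] ∑[ j ∈ Is ] ∑[ y ∈ Xs ] ∑[ y′ ∈ Xs ] ((e y * e y′) * (φ y j (t ∙ s) * φ y′ j (t′ ∙ s))))
      ≡⟨ trans (∑-cong Ts λ s → ∑-swap Is Xs _) (∑-swap Ts Xs _) ⟩
    (∑[ y ∈ Xs ] ∑[ s ∈ Ts ] ∑[ j ∈ Is ] ∑[ y′ ∈ Xs ] ((e y * e y′) * (φ y j (t ∙ s) * φ y′ j (t′ ∙ s))))
      ≡⟨ ∑-cong Xs (λ y → trans (∑-cong Ts λ s → ∑-swap Is Xs _) (∑-swap Ts Xs _)) ⟩
    (∑[ y ∈ Xs ] ∑[ y′ ∈ Xs ] ∑[ s ∈ Ts ] ∑[ j ∈ Is ] ((e y * e y′) * (φ y j (t ∙ s) * φ y′ j (t′ ∙ s))))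
      ≡⟨ ∑-cong Xs (λ y → ∑-cong Xs λ y′ → trans (∑-cong Ts λ s → ∑-*ˡ Is (e y * e y′) _) (∑-*ˡ Ts (e y * e y′) _)) ⟩
    (∑[ y ∈ Xs ] ∑[ y′ ∈ Xs ] ((e y * e y′) * correlation t t′ y y′))
      ≤⟨ ∑-mono Xs (λ y → ∑-mono Xs λ y′ → bound y y′ (e-support y) (e-support y′)) ⟩
    (∑[ y ∈ Xs ] ∑[ y′ ∈ Xs ] (Q * ((e y * e y′) * match t t′ y y′)))
      ≡⟨ trans (∑-cong Xs λ y → ∑-*ˡ Xs Q _) (∑-*ˡ Xs Q _) ⟩
    Q * coincidences t t′ ∎
    where
    open ≤-Reasoning
    Q : ℤ
    Q = (q * M) * (q * M)
    vanish : ∀ {u} v w → u ≡ 0ℤ → u * v ≤ Q * (u * w)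
    vanish v w refl = ≤-reflexive (trans (*-zeroˡ v) (sym (trans (cong (Q *_) (*-zeroˡ w)) (*-zeroʳ Q))))
    bound : ∀ y y′ → e y ≡ 0ℤ ⊎ y ≢ 0ⱽ → e y′ ≡ 0ℤ ⊎ y′ ≢ 0ⱽ →
      (e y * e y′) * correlation t t′ y y′ ≤ Q * ((e y * e y′) * match t t′ y y′)
    bound y y′ (inj₁ ey≡0) _ = vanish _ (match t t′ y y′) (trans (cong (_* e y′) ey≡0) (*-zeroˡ (e y′)))
    bound y y′ (inj₂ _) (inj₁ ey′≡0) = vanish _ (match t t′ y y′) (trans (cong (e y *_) ey′≡0) (*-zeroʳ (e y)))
    bound y y′ (inj₂ y≢0) (inj₂ y′≢0) = ≤-trans
      (*-monoˡ (*-nonNeg (e-nonNeg y) (e-nonNeg y′)) (correlation≤ t t′ y≢0 y′≢0))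
      (≤-reflexive (exchange (e y * e y′) Q (match t t′ y y′)))

  _≟ᵀⱽ_ : DecidableEquality (T × V)
  _≟ᵀⱽ_ = Product.≡-dec _≟ᵀ_ _≟ⱽ_

  -- The matching conditions give α γ′ = α′ γ and the form gives α γ = α′ γ′, so α² = α′².
  rigidity : ∀ {α γ α′ γ′ x z y y′ c} → α ≢ 0ᴷ → γ ≢ 0ᴷ → c ≢ 0ᴷ → y ≢ 0ⱽ →
    B (γ · z) (α · x) ≡ c → B (γ′ · z) (α′ · x) ≡ c → α′ · y ≡ α · y′ → γ′ · y ≡ γ · y′ →
    ((α′ , γ′) , y′) ≡ ((α , γ) , y) ⊎ ((α′ , γ′) , y′) ≡ ((-ᴷ α , -ᴷ γ) , (-ᴷ 1ᴷ) · y)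
  rigidity {α} {γ} {α′} {γ′} {x} {z} {y} {y′} {c} α≢0 γ≢0 c≢0 y≢0 Bγα≡c Bγ′α′≡c α′y≡αy′ γ′y≡γy′ = conclude (square-eq⇒± α′ α squares)
    where
    open ≡-Reasoning
    B-scale : ∀ a b → B (b · z) (a · x) ≡ (a *ᴷ b) *ᴷ B z x
    B-scale a b = trans (L.·ˡ b z (a · x)) (trans (cong (b *ᴷ_) (L.·ʳ a z x))
      (trans (sym (K.*-assoc b a _)) (cong (_*ᴷ B z x) (K.*-comm b a))))
    Bzx≢0 : B z x ≢ 0ᴷ
    Bzx≢0 B≡0 = c≢0 (trans (sym Bγα≡c) (trans (B-scale α γ) (trans (cong (_ *ᴷ_) B≡0) (K.zeroʳ _))))
    αγ≡α′γ′ : α *ᴷ γ ≡ α′ *ᴷ γ′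
    αγ≡α′γ′ = *-cancelʳ Bzx≢0 (trans (sym (B-scale α γ)) (trans Bγα≡c (trans (sym Bγ′α′≡c) (B-scale α′ γ′))))
    αγ′≡γα′ : α *ᴷ γ′ ≡ γ *ᴷ α′
    αγ′≡γα′ = ·-cancelʳ y y≢0 (begin
      (α *ᴷ γ′) · y   ≡⟨ sym (·-assoc α γ′ y) ⟩
      α · (γ′ · y)    ≡⟨ cong (α ·_) γ′y≡γy′ ⟩
      α · (γ · y′)    ≡⟨ trans (·-assoc α γ y′) (trans (cong (_· y′) (K.*-comm α γ)) (sym (·-assoc γ α y′))) ⟩
      γ · (α · y′)    ≡⟨ cong (γ ·_) (sym α′y≡αy′) ⟩
      γ · (α′ · y)    ≡⟨ ·-assoc γ α′ y ⟩
      (γ *ᴷ α′) · y   ∎)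
    squares : α′ *ᴷ α′ ≡ α *ᴷ α
    squares = *-cancelˡ γ≢0 (begin
      γ *ᴷ (α′ *ᴷ α′)  ≡⟨ sym (K.*-assoc γ α′ α′) ⟩
      (γ *ᴷ α′) *ᴷ α′  ≡⟨ cong (_*ᴷ α′) (sym αγ′≡γα′) ⟩
      (α *ᴷ γ′) *ᴷ α′  ≡⟨ trans (K.*-assoc α γ′ α′) (cong (α *ᴷ_) (K.*-comm γ′ α′)) ⟩
      α *ᴷ (α′ *ᴷ γ′)  ≡⟨ cong (α *ᴷ_) (sym αγ≡α′γ′) ⟩
      α *ᴷ (α *ᴷ γ)    ≡⟨ trans (sym (K.*-assoc α α γ)) (K.*-comm (α *ᴷ α) γ) ⟩
      γ *ᴷ (α *ᴷ α)    ∎)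
    negate : ∀ a → -ᴷ a ≡ a *ᴷ (-ᴷ 1ᴷ)
    negate a = trans (sym (KP.-1*x≈-x a)) (K.*-comm _ a)
    conclude : α′ ≡ α ⊎ α′ ≡ -ᴷ α → _
    conclude (inj₁ refl) = inj₁ (cong₂ _,_ (cong (α ,_) (sym (*-cancelˡ α≢0 αγ≡α′γ′))) (sym (·-cancelˡ α≢0 α′y≡αy′)))
    conclude (inj₂ refl) = inj₂ (cong₂ _,_
      (cong (-ᴷ α ,_) (*-cancelˡ α≢0 (trans αγ′≡γα′ (trans (sym (KP.-‿distribʳ-* γ α)) (trans (cong -ᴷ_ (K.*-comm γ α)) (KP.-‿distribʳ-* α γ))))))
      (sym (·-cancelˡ α≢0 (trans (·-assoc α _ y) (trans (cong (_· y) (sym (negate α))) α′y≡αy′)))))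

  -- The two points permitted by `rigidity`, counted with multiplicity: they merge in characteristic
  -- 2, where the value can be 2. The bound 2 on the total holds in either case.
  neighbours : T → V → T → V → ℤ
  neighbours t y t′ y′ = ⟦ (t′ , y′) ≟ᵀⱽ (t , y) ⟧ + ⟦ (t′ , y′) ≟ᵀⱽ (-ᵀ t , (-ᴷ 1ᴷ) · y) ⟧

  neighbours-nonNeg : ∀ t y t′ y′ → 0ℤ ≤ neighbours t y t′ y′
  neighbours-nonNeg t y t′ y′ = +-mono-≤ (⟦⟧-nonNeg ((t′ , y′) ≟ᵀⱽ (t , y))) (⟦⟧-nonNeg ((t′ , y′) ≟ᵀⱽ (-ᵀ t , (-ᴷ 1ᴷ) · y)))

  -- The left side vanishes unless rigidity applies.
  summand≤ : ∀ {c t t′} i y y′ → c ∈ Us → t ∈ Ts →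
    (ω c (t ⋆ i) * ω c (t′ ⋆ i)) * ((e y * e y′) * match t t′ y y′) ≤ (ω c (t ⋆ i) * e y) * neighbours t y t′ y′
  summand≤ {c} {t@(α , γ)} {t′@(α′ , γ′)} i@(x , z) y y′ c∈ t∈ =
    go (B (γ · z) (α · x) ≟ c) (B (γ′ · z) (α′ · x) ≟ c) (e-support y) (α′ · y ≟ⱽ α · y′) (γ′ · y ≟ⱽ γ · y′)
    where
    α≢0 = Us≢0 (proj₁ (∈-cartesianProduct⁻ Us Us t∈))
    γ≢0 = Us≢0 (proj₂ (∈-cartesianProduct⁻ Us Us t∈))
    a≥0 : 0ℤ ≤ ω c (t ⋆ i) * e y
    a≥0 = *-nonNeg (ω-nonNeg c (t ⋆ i)) (e-nonNeg y)
    rhs≥0 : 0ℤ ≤ (ω c (t ⋆ i) * e y) * neighbours t y t′ y′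
    rhs≥0 = *-nonNeg a≥0 (neighbours-nonNeg t y t′ y′)
    regroup : ∀ a a′ b b′ u → (a * a′) * ((b * b′) * u) ≡ (a * b) * (a′ * (b′ * u))
    regroup = solve-∀
    rest≤1 : ω c (t′ ⋆ i) * (e y′ * match t t′ y y′) ≤ 1ℤ
    rest≤1 = *-mono (ω-nonNeg c (t′ ⋆ i)) (+≤+ ℕ.z≤n) (ω≤1 c (t′ ⋆ i))
      (*-mono (e-nonNeg y′) (+≤+ ℕ.z≤n) (e≤1 y′)
        (*-mono (⟦⟧-nonNeg (α′ · y ≟ⱽ α · y′)) (+≤+ ℕ.z≤n) (⟦⟧≤1 (α′ · y ≟ⱽ α · y′)) (⟦⟧≤1 (γ′ · y ≟ⱽ γ · y′))))
    1≤neighbours : (t′ , y′) ≡ (t , y) ⊎ (t′ , y′) ≡ (-ᵀ t , (-ᴷ 1ᴷ) · y) → 1ℤ ≤ neighbours t y t′ y′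
    1≤neighbours (inj₁ p) = +-mono-≤ (≤-reflexive (sym (⟦⟧-true ((t′ , y′) ≟ᵀⱽ (t , y)) p))) (⟦⟧-nonNeg ((t′ , y′) ≟ᵀⱽ (-ᵀ t , (-ᴷ 1ᴷ) · y)))
    1≤neighbours (inj₂ p) = +-mono-≤ (⟦⟧-nonNeg ((t′ , y′) ≟ᵀⱽ (t , y))) (≤-reflexive (sym (⟦⟧-true ((t′ , y′) ≟ᵀⱽ (-ᵀ t , (-ᴷ 1ᴷ) · y)) p)))
    a0 : ∀ {u a} → a ≡ 0ℤ → u * a ≡ 0ℤ
    a0 {u} refl = *-zeroʳ u
    0a : ∀ {u a} → a ≡ 0ℤ → a * u ≡ 0ℤ
    0a {u} refl = *-zeroˡ u
    go : Dec (B (γ · z) (α · x) ≡ c) → Dec (B (γ′ · z) (α′ · x) ≡ c) → e y ≡ 0ℤ ⊎ y ≢ 0ⱽ →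
      Dec (α′ · y ≡ α · y′) → Dec (γ′ · y ≡ γ · y′) →
      (ω c (t ⋆ i) * ω c (t′ ⋆ i)) * ((e y * e y′) * match t t′ y y′) ≤ (ω c (t ⋆ i) * e y) * neighbours t y t′ y′
    go (no ¬p) _ _ _ _ =
      ≤-trans (≤-reflexive (0a (0a (a0 {e (α · x) * e (γ · z)} (⟦⟧-false (B (γ · z) (α · x) ≟ c) ¬p))))) rhs≥0
    go (yes _) (no ¬p) _ _ _ =
      ≤-trans (≤-reflexive (0a (a0 {ω c (t ⋆ i)} (a0 {e (α′ · x) * e (γ′ · z)} (⟦⟧-false (B (γ′ · z) (α′ · x) ≟ c) ¬p))))) rhs≥0
    go (yes _) (yes _) (inj₁ ey≡0) _ _ =
      ≤-trans (≤-reflexive (a0 {ω c (t ⋆ i) * ω c (t′ ⋆ i)} (0a (0a ey≡0)))) rhs≥0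
    go (yes _) (yes _) (inj₂ _) (no ¬r) _ =
      ≤-trans (≤-reflexive (a0 {ω c (t ⋆ i) * ω c (t′ ⋆ i)} (a0 {e y * e y′} (0a (⟦⟧-false (α′ · y ≟ⱽ α · y′) ¬r))))) rhs≥0
    go (yes _) (yes _) (inj₂ _) (yes _) (no ¬r) =
      ≤-trans (≤-reflexive (a0 {ω c (t ⋆ i) * ω c (t′ ⋆ i)} (a0 {e y * e y′} (a0 {⟦ α′ · y ≟ⱽ α · y′ ⟧} (⟦⟧-false (γ′ · y ≟ⱽ γ · y′) ¬r))))) rhs≥0
    go (yes p) (yes p′) (inj₂ y≢0) (yes r) (yes r′) = begin
      (ω c (t ⋆ i) * ω c (t′ ⋆ i)) * ((e y * e y′) * match t t′ y y′)
        ≡⟨ regroup (ω c (t ⋆ i)) (ω c (t′ ⋆ i)) (e y) (e y′) (match t t′ y y′) ⟩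
      (ω c (t ⋆ i) * e y) * (ω c (t′ ⋆ i) * (e y′ * match t t′ y y′))
        ≤⟨ *-monoˡ a≥0 (≤-trans rest≤1 (1≤neighbours (rigidity {x = x} {z} α≢0 γ≢0 (Us≢0 c∈) y≢0 p p′ r r′))) ⟩
      (ω c (t ⋆ i) * e y) * neighbours t y t′ y′ ∎
      where open ≤-Reasoning

  -- A pair `(x , z)` has a single value `B z x`, so it contributes to at most one `c`.
  ∑ω≤ : (∑[ c ∈ Us ] ∑ Is (ω c)) ≤ m * m
  ∑ω≤ = begin
    (∑[ c ∈ Us ] ∑ Is (ω c))
      ≡⟨ ∑-cong Us (λ c → ∑-cartesianProduct Xs Xs (ω c)) ⟩
    (∑[ c ∈ Us ] ∑[ x ∈ Xs ] ∑[ z ∈ Xs ] ω c (x , z))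
      ≡⟨ trans (∑-swap Us Xs _) (∑-cong Xs λ x → ∑-swap Us Xs _) ⟩
    (∑[ x ∈ Xs ] ∑[ z ∈ Xs ] ∑[ c ∈ Us ] ω c (x , z))
      ≤⟨ ∑-mono Xs (λ x → ∑-mono Xs λ z → ≤-trans (≤-reflexive (∑-*ˡ Us (e x * e z) _))
           (≤-trans (*-monoˡ (*-nonNeg (e-nonNeg x) (e-nonNeg z)) (≤-trans
             (≤-reflexive (∑-cong Us λ c → ⟦⟧-cong (B z x ≟ c) (c ≟ B z x) sym sym)) (∑-⟦⟧≤1 _≟_ (B z x) Us!)))
             (≤-reflexive (*-identityʳ (e x * e z))))) ⟩
    (∑[ x ∈ Xs ] ∑[ z ∈ Xs ] (e x * e z))
      ≡⟨ sym (∑-*-∑ Xs Xs e e) ⟩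
    m * m ∎
    where open ≤-Reasoning

  ∑neighbours≤2 : ∀ t y → (∑[ t′ ∈ Ts ] ∑[ y′ ∈ Xs ] neighbours t y t′ y′) ≤ + 2
  ∑neighbours≤2 t y = begin
    (∑[ t′ ∈ Ts ] ∑[ y′ ∈ Xs ] neighbours t y t′ y′)
      ≡⟨ sym (∑-cartesianProduct Ts Xs _) ⟩
    (∑[ p ∈ cartesianProduct Ts Xs ] (⟦ p ≟ᵀⱽ (t , y) ⟧ + ⟦ p ≟ᵀⱽ (-ᵀ t , (-ᴷ 1ᴷ) · y) ⟧))
      ≡⟨ ∑-+ (cartesianProduct Ts Xs) _ _ ⟩
    (∑[ p ∈ cartesianProduct Ts Xs ] ⟦ p ≟ᵀⱽ (t , y) ⟧) + (∑[ p ∈ cartesianProduct Ts Xs ] ⟦ p ≟ᵀⱽ (-ᵀ t , (-ᴷ 1ᴷ) · y) ⟧)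
      ≤⟨ +-mono-≤ (∑-⟦⟧≤1 _≟ᵀⱽ_ _ (Unique.cartesianProduct⁺ Ts! Xs!)) (∑-⟦⟧≤1 _≟ᵀⱽ_ _ (Unique.cartesianProduct⁺ Ts! Xs!)) ⟩
    + 2 ∎
    where open ≤-Reasoning

  -- For fixed `c`, `i`, `t` and `y`, at most two choices of `(t′ , y′)` survive. Summing over `y`
  -- then gives `m * + 2`, and summing the remaining weight over `i` and `c` gives at most `m * m`
  -- for each `t`.
  ∑ωω-coincidences≤ : (∑[ c ∈ Us ] ∑[ i ∈ Is ] ∑[ t ∈ Ts ] ∑[ t′ ∈ Ts ] ((ω c (t ⋆ i) * ω c (t′ ⋆ i)) * coincidences t t′))
    ≤ card Ts * ((m * m) * (m * + 2))
  ∑ωω-coincidences≤ = begin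
    (∑[ c ∈ Us ] ∑[ i ∈ Is ] ∑[ t ∈ Ts ] ∑[ t′ ∈ Ts ] ((ω c (t ⋆ i) * ω c (t′ ⋆ i)) * coincidences t t′))
      ≤⟨ ∑-mono-∈ Us (λ c∈ → ∑-mono Is λ i → ∑-mono-∈ Ts λ t∈ → bound i c∈ t∈) ⟩
    (∑[ c ∈ Us ] ∑[ i ∈ Is ] ∑[ t ∈ Ts ] (ω c (t ⋆ i) * (m * + 2)))
      ≡⟨ trans (∑-cong Us λ c → ∑-swap Is Ts _) (∑-swap Us Ts _) ⟩
    (∑[ t ∈ Ts ] ∑[ c ∈ Us ] ∑[ i ∈ Is ] (ω c (t ⋆ i) * (m * + 2)))
      -- Dilation by `t` permutes `Is`, so the inner sum does not depend on `t`.
      ≡⟨ ∑-cong-∈ Ts (λ t∈ → trans (∑-cong Us λ c → trans (∑-Is-⋆ t∈ (λ i → ω c i * (m * + 2))) (∑-*ʳ Is (m * + 2) (ω c))) (∑-*ʳ Us (m * + 2) _)) ⟩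
    (∑[ t ∈ Ts ] ((∑[ c ∈ Us ] ∑ Is (ω c)) * (m * + 2)))
      ≡⟨ ∑-const Ts _ ⟩
    card Ts * ((∑[ c ∈ Us ] ∑ Is (ω c)) * (m * + 2))
      ≤⟨ *-monoˡ (card-nonNeg Ts) (*-monoʳ (*-nonNeg m≥0 (+≤+ ℕ.z≤n)) ∑ω≤) ⟩
    card Ts * ((m * m) * (m * + 2)) ∎
    where
    open ≤-Reasoning
    bound : ∀ i {c t} → c ∈ Us → t ∈ Ts →
      (∑[ t′ ∈ Ts ] ((ω c (t ⋆ i) * ω c (t′ ⋆ i)) * coincidences t t′)) ≤ ω c (t ⋆ i) * (m * + 2)
    bound i {c} {t} c∈ t∈ = begin
      (∑[ t′ ∈ Ts ] ((ω c (t ⋆ i) * ω c (t′ ⋆ i)) * coincidences t t′))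
        ≡⟨ ∑-cong Ts (λ t′ → trans (sym (∑-*ˡ Xs (ω c (t ⋆ i) * ω c (t′ ⋆ i)) _))
             (∑-cong Xs λ y → sym (∑-*ˡ Xs (ω c (t ⋆ i) * ω c (t′ ⋆ i)) _))) ⟩
      (∑[ t′ ∈ Ts ] ∑[ y ∈ Xs ] ∑[ y′ ∈ Xs ] ((ω c (t ⋆ i) * ω c (t′ ⋆ i)) * ((e y * e y′) * match t t′ y y′)))
        ≤⟨ ∑-mono Ts (λ t′ → ∑-mono Xs λ y → ∑-mono Xs λ y′ → summand≤ i y y′ c∈ t∈) ⟩
      (∑[ t′ ∈ Ts ] ∑[ y ∈ Xs ] ∑[ y′ ∈ Xs ] ((ω c (t ⋆ i) * e y) * neighbours t y t′ y′))
        ≡⟨ ∑-swap Ts Xs _ ⟩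
      (∑[ y ∈ Xs ] ∑[ t′ ∈ Ts ] ∑[ y′ ∈ Xs ] ((ω c (t ⋆ i) * e y) * neighbours t y t′ y′))
        ≡⟨ ∑-cong Xs (λ y → trans (∑-cong Ts λ t′ → ∑-*ˡ Xs (ω c (t ⋆ i) * e y) _) (∑-*ˡ Ts (ω c (t ⋆ i) * e y) _)) ⟩
      (∑[ y ∈ Xs ] ((ω c (t ⋆ i) * e y) * (∑[ t′ ∈ Ts ] ∑[ y′ ∈ Xs ] neighbours t y t′ y′)))
        ≤⟨ ∑-mono Xs (λ y → *-monoˡ (*-nonNeg (ω-nonNeg c (t ⋆ i)) (e-nonNeg y)) (∑neighbours≤2 t y)) ⟩
      (∑[ y ∈ Xs ] ((ω c (t ⋆ i) * e y) * + 2))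
        ≡⟨ trans (∑-*ʳ Xs (+ 2) _) (cong (_* + 2) (∑-*ˡ Xs (ω c (t ⋆ i)) e)) ⟩
      (ω c (t ⋆ i) * m) * + 2
        ≡⟨ *-assoc (ω c (t ⋆ i)) m (+ 2) ⟩
      ω c (t ⋆ i) * (m * + 2) ∎

  open GroupAction Is Ts _⋆_ _∙_ ∙-assoc ∙-comm ∑-Is-⋆ ∑-Ts-∙ N
    (λ t∈ i s → ∑-cong Xs λ y → cong (e y *_) (φ-equivariant y t∈ i s))

  -- After `orbit-CauchySchwarz` the square is opened over `t` and `t′`. The weights `ω` do not
  -- involve `j` and `s`, so `∑NN≤` bounds that inner sum over all pairs of vectors first.
  energy-scaled : (card Ts * card Ts) * (∑[ c ∈ Us ] ∑[ s ∈ Ts ] (D c s * D c s))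
    ≤ ((q * M) * (q * M)) * (card Ts * ((m * m) * (m * + 2)))
  energy-scaled = begin
    (card Ts * card Ts) * (∑[ c ∈ Us ] ∑[ s ∈ Ts ] (D c s * D c s))
      ≡⟨ sym (∑-*ˡ Us (card Ts * card Ts) _) ⟩
    (∑[ c ∈ Us ] ((card Ts * card Ts) * (∑[ s ∈ Ts ] (D c s * D c s))))
      ≤⟨ ∑-mono Us (λ c → orbit-CauchySchwarz (ω c)) ⟩
    (∑[ c ∈ Us ] ∑[ s ∈ Ts ] ∑[ i ∈ Is ] ∑[ j ∈ Is ] (U c s i j * U c s i j))
      ≡⟨ ∑-cong Us rearrange ⟩
    (∑[ c ∈ Us ] ∑[ i ∈ Is ] ∑[ t ∈ Ts ] ∑[ t′ ∈ Ts ] ((ω c (t ⋆ i) * ω c (t′ ⋆ i)) * (∑[ s ∈ Ts ] ∑[ j ∈ Is ] (N j (t ∙ s) * N j (t′ ∙ s)))))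
      ≤⟨ ∑-mono Us (λ c → ∑-mono Is λ i → ∑-mono Ts λ t → ∑-mono Ts λ t′ → ≤-trans
           (*-monoˡ (*-nonNeg (ω-nonNeg c (t ⋆ i)) (ω-nonNeg c (t′ ⋆ i))) (∑NN≤ t t′))
           (≤-reflexive (exchange (ω c (t ⋆ i) * ω c (t′ ⋆ i)) Q (coincidences t t′)))) ⟩
    (∑[ c ∈ Us ] ∑[ i ∈ Is ] ∑[ t ∈ Ts ] ∑[ t′ ∈ Ts ] (Q * ((ω c (t ⋆ i) * ω c (t′ ⋆ i)) * coincidences t t′)))
      ≡⟨ trans (∑-cong Us λ c → trans (∑-cong Is λ i → trans (∑-cong Ts λ t → ∑-*ˡ Ts Q _) (∑-*ˡ Ts Q _)) (∑-*ˡ Is Q _)) (∑-*ˡ Us Q _) ⟩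
    Q * (∑[ c ∈ Us ] ∑[ i ∈ Is ] ∑[ t ∈ Ts ] ∑[ t′ ∈ Ts ] ((ω c (t ⋆ i) * ω c (t′ ⋆ i)) * coincidences t t′))
      ≤⟨ *-monoˡ (*-nonNeg qM≥0 qM≥0) ∑ωω-coincidences≤ ⟩
    Q * (card Ts * ((m * m) * (m * + 2))) ∎
    where
    open ≤-Reasoning
    Q : ℤ
    Q = (q * M) * (q * M)
    U : K → T → I → I → ℤ
    U c s i j = ∑[ t ∈ Ts ] (ω c (t ⋆ i) * N j (t ∙ s))
    rearrange : ∀ c → (∑[ s ∈ Ts ] ∑[ i ∈ Is ] ∑[ j ∈ Is ] (U c s i j * U c s i j)) ≡
      (∑[ i ∈ Is ] ∑[ t ∈ Ts ] ∑[ t′ ∈ Ts ] ((ω c (t ⋆ i) * ω c (t′ ⋆ i)) * (∑[ s ∈ Ts ] ∑[ j ∈ Is ] (N j (t ∙ s) * N j (t′ ∙ s)))))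
    rearrange c = begin-equality
      (∑[ s ∈ Ts ] ∑[ i ∈ Is ] ∑[ j ∈ Is ] (U c s i j * U c s i j))
        ≡⟨ ∑-swap Ts Is _ ⟩
      (∑[ i ∈ Is ] ∑[ s ∈ Ts ] ∑[ j ∈ Is ] (U c s i j * U c s i j))
        ≡⟨ ∑-cong Is (λ i → ∑-cong Ts λ s → ∑-cong Is λ j → trans (∑-*-∑ Ts Ts _ _) (∑-cong Ts λ t → ∑-cong Ts λ t′ →
             interchange (ω c (t ⋆ i)) (N j (t ∙ s)) (ω c (t′ ⋆ i)) (N j (t′ ∙ s)))) ⟩
      (∑[ i ∈ Is ] ∑[ s ∈ Ts ] ∑[ j ∈ Is ] ∑[ t ∈ Ts ] ∑[ t′ ∈ Ts ] ((ω c (t ⋆ i) * ω c (t′ ⋆ i)) * (N j (t ∙ s) * N j (t′ ∙ s))))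
        ≡⟨ ∑-cong Is (λ i → trans (∑-cong Ts λ s → ∑-swap Is Ts _) (∑-swap Ts Ts _)) ⟩
      (∑[ i ∈ Is ] ∑[ t ∈ Ts ] ∑[ s ∈ Ts ] ∑[ j ∈ Is ] ∑[ t′ ∈ Ts ] ((ω c (t ⋆ i) * ω c (t′ ⋆ i)) * (N j (t ∙ s) * N j (t′ ∙ s))))
        ≡⟨ ∑-cong Is (λ i → ∑-cong Ts λ t → trans (∑-cong Ts λ s → ∑-swap Is Ts _) (∑-swap Ts Ts _)) ⟩
      (∑[ i ∈ Is ] ∑[ t ∈ Ts ] ∑[ t′ ∈ Ts ] ∑[ s ∈ Ts ] ∑[ j ∈ Is ] ((ω c (t ⋆ i) * ω c (t′ ⋆ i)) * (N j (t ∙ s) * N j (t′ ∙ s))))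
        ≡⟨ ∑-cong Is (λ i → ∑-cong Ts λ t → ∑-cong Ts λ t′ →
             trans (∑-cong Ts λ s → ∑-*ˡ Is (ω c (t ⋆ i) * ω c (t′ ⋆ i)) _) (∑-*ˡ Ts (ω c (t ⋆ i) * ω c (t′ ⋆ i)) _)) ⟩
      (∑[ i ∈ Is ] ∑[ t ∈ Ts ] ∑[ t′ ∈ Ts ] ((ω c (t ⋆ i) * ω c (t′ ⋆ i)) * (∑[ s ∈ Ts ] ∑[ j ∈ Is ] (N j (t ∙ s) * N j (t′ ∙ s))))) ∎

  1∈Us : 1ᴷ ∈ Us
  1∈Us = ∈Us (0≢1 ∘ sym)

  -- With `M = card Xs * n` and `card Ts = n * n`, both sides of `energy-scaled` contain the
  -- positive factor `n⁴`, which cancels.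
  energy : (∑[ c ∈ Us ] ∑[ s ∈ Ts ] (D c s * D c s)) ≤ + 2 * (((q * q) * (card Xs * card Xs)) * (m * (m * m)))
  energy = *-cancelˡ-≤-pos _ _ (card Ts * card Ts) {{positive (*-pos Ts>0 Ts>0)}} (≤-trans energy-scaled (≤-reflexive eq))
    where
    Ts>0 : 0ℤ < card Ts
    Ts>0 = 0<card (∈-cartesianProduct⁺ 1∈Us 1∈Us)
    rearrange : ∀ q X n m → ((q * (X * n)) * (q * (X * n))) * ((n * n) * ((m * m) * (m * + 2)))
      ≡ ((n * n) * (n * n)) * (+ 2 * (((q * q) * (X * X)) * (m * (m * m))))
    rearrange = solve-∀
    eq : ((q * M) * (q * M)) * (card Ts * ((m * m) * (m * + 2)))
      ≡ (card Ts * card Ts) * (+ 2 * (((q * q) * (card Xs * card Xs)) * (m * (m * m))))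
    eq = trans (cong₂ (λ M τ → ((q * M) * (q * M)) * (τ * ((m * m) * (m * + 2)))) (card-cartesianProduct Xs Us) (card-cartesianProduct Us Us))
      (trans (rearrange q (card Xs) n m) (cong (λ τ → (τ * τ) * (+ 2 * (((q * q) * (card Xs * card Xs)) * (m * (m * m))))) (sym (card-cartesianProduct Us Us))))

  -- The second moment of the number of pairs with a given value.

  pairs : K → ℤ
  pairs c = ∑ Is (ω c)

  -- A one-sided covariance: zero for vectors that are not proportional, negative for a ratio other
  -- than 1, and at most `q * M` on the diagonal.
  dispersion : ∀ y y′ → S y → S y′ →
    (∑[ p ∈ L.Ps ] ((L.h 1ᴷ y p - 1ℤ) * (L.h 1ᴷ y′ p - 1ℤ))) ≤ (q * M) * ⟦ y ≟ⱽ y′ ⟧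
  dispersion y y′ y∈S y′∈S = begin
    (∑[ p ∈ L.Ps ] ((L.h 1ᴷ y p - 1ℤ) * (L.h 1ᴷ y′ p - 1ℤ)))
      ≡⟨ ∑-cong L.Ps (λ p → expand (L.h 1ᴷ y p) (L.h 1ᴷ y′ p)) ⟩
    (∑[ p ∈ L.Ps ] (((L.h 1ᴷ y p * L.h 1ᴷ y′ p + 1ℤ) - L.h 1ᴷ y p) - L.h 1ᴷ y′ p))
      ≡⟨ trans (∑-- L.Ps _ _) (cong (_- ∑ L.Ps (L.h 1ᴷ y′)) (trans (∑-- L.Ps _ _) (cong (_- ∑ L.Ps (L.h 1ᴷ y)) (∑-+ L.Ps _ _)))) ⟩
    ((A + M) - ∑ L.Ps (L.h 1ᴷ y)) - ∑ L.Ps (L.h 1ᴷ y′)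
      ≡⟨ cong₂ (λ u v → ((A + M) - u) - v) (L.∑h 1ᴷ y≢0) (L.∑h 1ᴷ y′≢0) ⟩
    ((A + M) - M) - M
      ≡⟨ i+j-j-j≡i-j A M ⟩
    A - M
      ≤⟨ bound (any? (λ c → y ≟ⱽ c · y′) Ks) ⟩
    (q * M) * ⟦ y ≟ⱽ y′ ⟧ ∎
    where
    open ≤-Reasoning
    ≢0 : ∀ {x} → S x → x ≢ 0ⱽ
    ≢0 x∈S refl = 0∉S x∈S
    y≢0 = ≢0 y∈S
    y′≢0 = ≢0 y′∈S
    A : ℤ
    A = ∑[ p ∈ L.Ps ] (L.h 1ᴷ y p * L.h 1ᴷ y′ p)
    expand : ∀ a b → (a - 1ℤ) * (b - 1ℤ) ≡ ((a * b + 1ℤ) - a) - b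
    expand = solve-∀
    rhs≥0 : 0ℤ ≤ (q * M) * ⟦ y ≟ⱽ y′ ⟧
    rhs≥0 = *-nonNeg qM≥0 (⟦⟧-nonNeg (y ≟ⱽ y′))
    bound : Dec _ → A - M ≤ (q * M) * ⟦ y ≟ⱽ y′ ⟧
    bound (no ¬p) = ≤-trans (≤-reflexive (trans (cong (_- M) (L.∑hh 1ᴷ 1ᴷ y′≢0 λ c e → ¬p (lose (∈Ks c) e))) (+-inverseʳ M))) rhs≥0
    bound (yes p) with satisfied p
    ... | c , refl with 1ᴷ ≟ c *ᴷ 1ᴷ
    ... | no 1≢c  = ≤-trans (≤-trans (i-k≤i M≥0) (≤-reflexive (L.∑hh-mismatch 1ᴷ 1ᴷ c y′ 1≢c))) rhs≥0
    ... | yes 1≡c = ≤-trans (≤-trans (i-k≤i M≥0) (L.∑hh≤ 1ᴷ 1ᴷ y′ y≢0)) (≤-reflexive (sym (trans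
      (cong ((q * M) *_) (⟦⟧-true (y ≟ⱽ y′) (trans (cong (_· y′) (trans (sym (K.*-identityʳ c)) (sym 1≡c))) (·-identityˡ y′)))) (*-identityʳ (q * M)))))

  -- Write the deviation as a sum over `z` of `G z c`, the contribution of all `x`. Cauchy-Schwarz
  -- in `z` costs a factor `m`; the remaining square is opened over `x` and `x′`, where `dispersion`
  -- leaves only the diagonal.
  variance : (∑[ c ∈ Us ] ((q * pairs c - m * m) * (q * pairs c - m * m))) ≤ m * ((q * M) * m)
  variance = begin
    (∑[ c ∈ Us ] ((q * pairs c - m * m) * (q * pairs c - m * m)))
      ≡⟨ ∑-cong Us (λ c → cong (λ u → u * u) (recentre c)) ⟩
    (∑[ c ∈ Us ] ((∑[ z ∈ Xs ] (e z * G z c)) * (∑[ z ∈ Xs ] (e z * G z c))))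
      ≤⟨ ∑-mono Us (λ c → ∑-CauchySchwarz Xs e (λ z → G z c) e-nonNeg) ⟩
    (∑[ c ∈ Us ] (m * (∑[ z ∈ Xs ] (e z * (G z c * G z c)))))
      ≡⟨ ∑-*ˡ Us m _ ⟩
    m * (∑[ c ∈ Us ] ∑[ z ∈ Xs ] (e z * (G z c * G z c)))
      -- Squares are nonnegative, so the sum may be extended to all vectors `z`, over which
      -- equidistribution is exact.
      ≤⟨ *-monoˡ m≥0 (∑-mono Us λ c → ∑-mono Xs λ z → ≤-trans (*-monoʳ (square-nonNeg (G z c)) (e≤1 z)) (≤-reflexive (*-identityˡ _))) ⟩
    m * (∑[ c ∈ Us ] ∑[ z ∈ Xs ] (G z c * G z c))
      ≡⟨ cong (m *_) (trans (∑-swap Us Xs _) (sym (∑-cartesianProduct Xs Us (λ p → G (proj₁ p) (proj₂ p) * G (proj₁ p) (proj₂ p))))) ⟩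
    m * (∑[ p ∈ L.Ps ] (G (proj₁ p) (proj₂ p) * G (proj₁ p) (proj₂ p)))
      ≡⟨ cong (m *_) (trans (∑-cong L.Ps λ p → trans (∑-*-∑ Xs Xs _ _) (∑-cong Xs λ x → ∑-cong Xs λ x′ →
           interchange (e x) (L.h 1ᴷ x p - 1ℤ) (e x′) (L.h 1ᴷ x′ p - 1ℤ)))
           (trans (∑-swap L.Ps Xs _) (∑-cong Xs λ x → trans (∑-swap L.Ps Xs _) (∑-cong Xs λ x′ → ∑-*ˡ L.Ps (e x * e x′) _)))) ⟩
    m * (∑[ x ∈ Xs ] ∑[ x′ ∈ Xs ] ((e x * e x′) * (∑[ p ∈ L.Ps ] ((L.h 1ᴷ x p - 1ℤ) * (L.h 1ᴷ x′ p - 1ℤ)))))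
      ≤⟨ *-monoˡ m≥0 (∑-mono Xs λ x → ∑-mono Xs λ x′ → bound x x′ (S? x) (S? x′)) ⟩
    m * (∑[ x ∈ Xs ] ∑[ x′ ∈ Xs ] ((q * M) * (e x * ⟦ x′ ≟ⱽ x ⟧)))
      ≡⟨ cong (m *_) (trans (∑-cong Xs λ x → trans (∑-*ˡ Xs (q * M) _) (cong ((q * M) *_)
           (trans (∑-*ˡ Xs (e x) _) (trans (cong (e x *_) (∑-⟦⟧-unique _≟ⱽ_ Xs! (∈vectors x))) (*-identityʳ (e x)))))) (∑-*ˡ Xs (q * M) e)) ⟩
    m * ((q * M) * m) ∎
    where
    open ≤-Reasoning
    G : V → K → ℤ
    G z c = ∑[ x ∈ Xs ] (e x * (L.h 1ᴷ x (z , c) - 1ℤ))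
    expand : ∀ a b q u → b * (a * (q * u - 1ℤ)) ≡ q * ((a * b) * u) - a * b
    expand = solve-∀
    recentre : ∀ c → q * pairs c - m * m ≡ (∑[ z ∈ Xs ] (e z * G z c))
    recentre c = sym (begin-equality
      (∑[ z ∈ Xs ] (e z * G z c))
        ≡⟨ trans (∑-cong Xs λ z → sym (∑-*ˡ Xs (e z) _)) (∑-swap Xs Xs _) ⟩
      (∑[ x ∈ Xs ] ∑[ z ∈ Xs ] (e z * (e x * (L.h 1ᴷ x (z , c) - 1ℤ))))
        ≡⟨ ∑-cong Xs (λ x → ∑-cong Xs λ z → trans (cong (λ b → e z * (e x * (q * ⟦ B z x ≟ b ⟧ - 1ℤ))) (K.*-identityˡ c))
             (expand (e x) (e z) q ⟦ B z x ≟ c ⟧)) ⟩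
      (∑[ x ∈ Xs ] ∑[ z ∈ Xs ] (q * ω c (x , z) - e x * e z))
        ≡⟨ trans (∑-cong Xs λ x → ∑-- Xs _ _) (∑-- Xs _ _) ⟩
      (∑[ x ∈ Xs ] ∑[ z ∈ Xs ] (q * ω c (x , z))) - (∑[ x ∈ Xs ] ∑[ z ∈ Xs ] (e x * e z))
        ≡⟨ cong₂ _-_ (trans (sym (∑-cartesianProduct Xs Xs _)) (∑-*ˡ Is q (ω c))) (sym (∑-*-∑ Xs Xs e e)) ⟩
      q * pairs c - m * m ∎)
    bound : ∀ x x′ (s : Dec (S x)) (s′ : Dec (S x′)) →
      (⟦ s ⟧ * ⟦ s′ ⟧) * (∑[ p ∈ L.Ps ] ((L.h 1ᴷ x p - 1ℤ) * (L.h 1ᴷ x′ p - 1ℤ))) ≤ (q * M) * (⟦ s ⟧ * ⟦ x′ ≟ⱽ x ⟧)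
    bound x x′ (no _) _ = ≤-reflexive (trans (*-zeroˡ (∑[ p ∈ L.Ps ] ((L.h 1ᴷ x p - 1ℤ) * (L.h 1ᴷ x′ p - 1ℤ)))) (sym (*-zeroʳ (q * M))))
    bound x x′ (yes _) (no _) = ≤-trans (≤-reflexive (*-zeroˡ (∑[ p ∈ L.Ps ] ((L.h 1ᴷ x p - 1ℤ) * (L.h 1ᴷ x′ p - 1ℤ)))))
      (*-nonNeg qM≥0 (*-nonNeg {1ℤ} (+≤+ ℕ.z≤n) (⟦⟧-nonNeg (x′ ≟ⱽ x))))
    bound x x′ (yes s) (yes s′) = ≤-trans (≤-reflexive (*-identityˡ _)) (≤-trans (dispersion x x′ s s′)
      (*-monoˡ qM≥0 (≤-reflexive (trans (⟦⟧-cong (x ≟ⱽ x′) (x′ ≟ⱽ x) sym sym) (sym (*-identityˡ _))))))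

  -- No `(x , y , z)` satisfies all three conditions, so in every term of `D` only the centring
  -- constant `- 1ℤ` of `φ` survives.
  D-unattained : ∀ {a b c} → (∀ {x y z} → S x → S y → S z → ¬ (B x y ≡ a × B y z ≡ b × B z x ≡ c)) → D c (a , b) ≡ - (pairs c * m)
  D-unattained {a} {b} {c} ¬attained = begin
    (∑[ i ∈ Is ] (ω c i * N i (a , b)))
      ≡⟨ ∑-cong Is (λ i → sym (∑-*ˡ Xs (ω c i) _)) ⟩
    (∑[ i ∈ Is ] ∑[ y ∈ Xs ] (ω c i * (e y * φ y i (a , b))))
      ≡⟨ ∑-cong Is (λ { (x , z) → ∑-cong Xs λ y → term x y z (S? x) (S? y) (S? z) (B x y ≟ a) (B y z ≟ b) (B z x ≟ c) }) ⟩
    (∑[ i ∈ Is ] ∑[ y ∈ Xs ] (- 1ℤ * (ω c i * e y)))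
      ≡⟨ trans (∑-cong Is λ i → ∑-*ˡ Xs (- 1ℤ) _) (∑-*ˡ Is (- 1ℤ) _) ⟩
    - 1ℤ * (∑[ i ∈ Is ] ∑[ y ∈ Xs ] (ω c i * e y))
      ≡⟨ trans (cong (- 1ℤ *_) (sym (∑-*-∑ Is Xs (ω c) e))) (-1*i≡-i (pairs c * m)) ⟩
    - (pairs c * m) ∎
    where
    open ≡-Reasoning
    W : ∀ {x y z} → Dec (S x) → Dec (S z) → Dec (B z x ≡ c) → Dec (S y) → Dec (B x y ≡ a) → Dec (B y z ≡ b) → ℤ
    W s s″ r s′ p p′ = ((⟦ s ⟧ * ⟦ s″ ⟧) * ⟦ r ⟧) * (⟦ s′ ⟧ * ((q * ⟦ p ⟧) * (q * ⟦ p′ ⟧) - 1ℤ))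
    zero-p : ∀ w v q u → w * (v * ((q * 0ℤ) * (q * u) - 1ℤ)) ≡ - 1ℤ * (w * v)
    zero-p = solve-∀
    zero-p′ : ∀ w v q u → w * (v * ((q * u) * (q * 0ℤ) - 1ℤ)) ≡ - 1ℤ * (w * v)
    zero-p′ = solve-∀
    zero-w : ∀ u v k → (u * 0ℤ) * (v * k) ≡ - 1ℤ * ((u * 0ℤ) * v)
    zero-w = solve-∀
    zero-v : ∀ w k → w * (0ℤ * k) ≡ - 1ℤ * (w * 0ℤ)
    zero-v = solve-∀
    zero-s : ∀ u r v k → ((0ℤ * u) * r) * (v * k) ≡ - 1ℤ * (((0ℤ * u) * r) * v)
    zero-s = solve-∀
    zero-s″ : ∀ u r v k → ((u * 0ℤ) * r) * (v * k) ≡ - 1ℤ * (((u * 0ℤ) * r) * v)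
    zero-s″ = solve-∀
    -- A failed condition on `a` or `b` kills the product in `φ`; any other failure makes both sides
    -- zero. The last case would attain the triple.
    term : ∀ x y z (s : Dec (S x)) (s′ : Dec (S y)) (s″ : Dec (S z)) (p : Dec (B x y ≡ a)) (p′ : Dec (B y z ≡ b)) (r : Dec (B z x ≡ c)) →
      W s s″ r s′ p p′ ≡ - 1ℤ * (((⟦ s ⟧ * ⟦ s″ ⟧) * ⟦ r ⟧) * ⟦ s′ ⟧)
    term x y z s s′ s″ (no _) p′ r = zero-p ((⟦ s ⟧ * ⟦ s″ ⟧) * ⟦ r ⟧) ⟦ s′ ⟧ q ⟦ p′ ⟧
    term x y z s s′ s″ p@(yes _) (no _) r = zero-p′ ((⟦ s ⟧ * ⟦ s″ ⟧) * ⟦ r ⟧) ⟦ s′ ⟧ q ⟦ p ⟧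
    term x y z s s′ s″ p@(yes _) p′@(yes _) (no _) = zero-w (⟦ s ⟧ * ⟦ s″ ⟧) ⟦ s′ ⟧ ((q * ⟦ p ⟧) * (q * ⟦ p′ ⟧) - 1ℤ)
    term x y z s (no _) s″ p@(yes _) p′@(yes _) r@(yes _) = zero-v ((⟦ s ⟧ * ⟦ s″ ⟧) * ⟦ r ⟧) ((q * ⟦ p ⟧) * (q * ⟦ p′ ⟧) - 1ℤ)
    term x y z (no _) s′@(yes _) s″ p@(yes _) p′@(yes _) r@(yes _) = zero-s ⟦ s″ ⟧ ⟦ r ⟧ ⟦ s′ ⟧ ((q * ⟦ p ⟧) * (q * ⟦ p′ ⟧) - 1ℤ)
    term x y z s@(yes _) s′@(yes _) (no _) p@(yes _) p′@(yes _) r@(yes _) = zero-s″ ⟦ s ⟧ ⟦ r ⟧ ⟦ s′ ⟧ ((q * ⟦ p ⟧) * (q * ⟦ p′ ⟧) - 1ℤ)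
    term x y z (yes s) (yes s′) (yes s″) (yes p) (yes p′) (yes r) = contradiction (p , p′ , r) (¬attained s s′ s″)

  -- With p = pairs c, the identity m² = q p - (q p - m²) gives m⁴ ≤ 2 q² p² + 2 (q p - m²)² for each unattained triple;
  -- the first term is controlled by energy and the second by variance.
  unattained-bound : ∀ (t : K → T → ℤ) →
    (∀ c s → t c s ≡ 1ℤ ⊎ t c s ≡ 0ℤ × D c s ≡ - (pairs c * m)) →
    ((m * m) * ((m * m) * (m * m))) * (n * (n * n) - (∑[ c ∈ Us ] ∑[ s ∈ Ts ] t c s))
    ≤ (+ 2 * (q * q)) * (+ 2 * (((q * q) * (card Xs * card Xs)) * (m * (m * m)))) + (+ 2 * (m * m)) * ((n * n) * (m * ((q * M) * m)))
  unattained-bound t t-dec = begin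
    m⁶ * (n * (n * n) - (∑[ c ∈ Us ] ∑[ s ∈ Ts ] t c s))
      ≡⟨ cong (λ u → m⁶ * (u - (∑[ c ∈ Us ] ∑[ s ∈ Ts ] t c s))) (sym total) ⟩
    m⁶ * ((∑[ c ∈ Us ] ∑[ s ∈ Ts ] 1ℤ) - (∑[ c ∈ Us ] ∑[ s ∈ Ts ] t c s))
      ≡⟨ cong (m⁶ *_) (sym (trans (∑-cong Us λ c → ∑-- Ts _ _) (∑-- Us _ _))) ⟩
    m⁶ * (∑[ c ∈ Us ] ∑[ s ∈ Ts ] (1ℤ - t c s))
      ≡⟨ sym (trans (∑-cong Us λ c → ∑-*ˡ Ts m⁶ _) (∑-*ˡ Us m⁶ _)) ⟩
    (∑[ c ∈ Us ] ∑[ s ∈ Ts ] (m⁶ * (1ℤ - t c s)))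
      ≤⟨ ∑-mono Us (λ c → ∑-mono Ts λ s → pointwise c s (t-dec c s)) ⟩
    (∑[ c ∈ Us ] ∑[ s ∈ Ts ] (k * (D c s * D c s) + l * (v c * v c)))
      ≡⟨ trans (∑-cong Us λ c → ∑-+ Ts _ _) (∑-+ Us _ _) ⟩
    (∑[ c ∈ Us ] ∑[ s ∈ Ts ] (k * (D c s * D c s))) + (∑[ c ∈ Us ] ∑[ s ∈ Ts ] (l * (v c * v c)))
      ≡⟨ cong₂ _+_ (trans (∑-cong Us λ c → ∑-*ˡ Ts k _) (∑-*ˡ Us k _))
           (trans (∑-cong Us λ c → trans (∑-*ˡ Ts l _) (cong (l *_) (trans (∑-const Ts (v c * v c)) (cong (_* (v c * v c)) (card-cartesianProduct Us Us)))))
             (trans (∑-*ˡ Us l _) (cong (l *_) (∑-*ˡ Us (n * n) _)))) ⟩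
    k * (∑[ c ∈ Us ] ∑[ s ∈ Ts ] (D c s * D c s)) + l * ((n * n) * (∑[ c ∈ Us ] (v c * v c)))
      ≤⟨ +-mono-≤ (*-monoˡ k≥0 energy) (*-monoˡ l≥0 (*-monoˡ (square-nonNeg n) variance)) ⟩
    k * (+ 2 * (((q * q) * (card Xs * card Xs)) * (m * (m * m)))) + l * ((n * n) * (m * ((q * M) * m))) ∎
    where
    open ≤-Reasoning
    m⁶ k l : ℤ
    m⁶ = (m * m) * ((m * m) * (m * m))
    k = + 2 * (q * q)
    l = + 2 * (m * m)
    v : K → ℤ
    v c = q * pairs c - m * m
    k≥0 : 0ℤ ≤ k
    k≥0 = *-nonNeg {+ 2} (+≤+ ℕ.z≤n) (square-nonNeg q)
    l≥0 : 0ℤ ≤ l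
    l≥0 = *-nonNeg {+ 2} (+≤+ ℕ.z≤n) (square-nonNeg m)
    total : (∑[ c ∈ Us ] ∑[ s ∈ Ts ] 1ℤ) ≡ n * (n * n)
    total = trans (∑-const Us (card Ts)) (cong (n *_) (card-cartesianProduct Us Us))
    -- With `u = q p` and `v = q p - m²` this is `2u² + 2v² - (u - v)² = (u + v)²`, multiplied by
    -- `m²`.
    defect : ∀ q p m → ((+ 2 * (q * q)) * (- (p * m) * - (p * m)) + (+ 2 * (m * m)) * ((q * p - m * m) * (q * p - m * m)))
      - ((m * m) * ((m * m) * (m * m))) * 1ℤ ≡ (m * m) * ((+ 2 * (q * p) - m * m) * (+ 2 * (q * p) - m * m))
    defect = solve-∀
    pointwise : ∀ c s → t c s ≡ 1ℤ ⊎ t c s ≡ 0ℤ × D c s ≡ - (pairs c * m) →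
      m⁶ * (1ℤ - t c s) ≤ k * (D c s * D c s) + l * (v c * v c)
    pointwise c s (inj₁ t≡1) = ≤-trans (≤-reflexive (trans (cong (λ u → m⁶ * (1ℤ - u)) t≡1) (*-zeroʳ m⁶)))
      (+-mono-≤ (*-nonNeg k≥0 (square-nonNeg (D c s))) (*-nonNeg l≥0 (square-nonNeg (v c))))
    pointwise c s (inj₂ (t≡0 , D≡)) = ≤-trans (≤-reflexive (cong (λ u → m⁶ * (1ℤ - u)) t≡0))
      (≤-trans (0≤i-j⇒j≤i (subst (0ℤ ≤_) (sym (defect q (pairs c) m)) (*-nonNeg (square-nonNeg m) (square-nonNeg (+ 2 * (q * pairs c) - m * m)))))
        (≤-reflexive (cong (λ u → k * (u * u) + l * (v c * v c)) (sym D≡))))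

-- Size estimates and explicit constants.

size-arithmetic : ∀ {q n X m l τ} → 1ℤ ≤ q → 0ℤ ≤ n → q ≤ + 2 * n → n ≤ q → 1ℤ ≤ X → 0ℤ ≤ m → m ≤ X → 0ℤ ≤ l → l ≤ m + 1ℤ → 0ℤ ≤ τ →
  + 1000 * (q * (X * X)) ≤ l * (l * l) →
  ((m * m) * ((m * m) * (m * m))) * (n * (n * n) - τ)
    ≤ (+ 2 * (q * q)) * (+ 2 * (((q * q) * (X * X)) * (m * (m * m)))) + (+ 2 * (m * m)) * ((n * n) * (m * ((q * (X * n)) * m))) →
  q * (q * q) ≤ + 16 * τ
size-arithmetic {q} {n} {X} {m} {l} {τ} 1≤q 0≤n q≤2n n≤q 1≤X 0≤m m≤X 0≤l l≤m+1 0≤τ large bound =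
  -- The estimates below give `77 q³ ≤ 1000 τ`, and `77 * 16 = 1232` exceeds 1000.
  *-cancelˡ-≤-pos (q * (q * q)) (+ 16 * τ) (+ 77) (begin
    + 77 * (q * (q * q))    ≤⟨ 77q³≤1000τ ⟩
    + 1000 * τ              ≤⟨ *-monoʳ {+ 1000} {+ 1232} 0≤τ (+≤+ (ℕP.m≤m+n 1000 232)) ⟩
    + 1232 * τ              ≡⟨ *-assoc (+ 77) (+ 16) τ ⟩
    + 77 * (+ 16 * τ)       ∎)
  where
  open ≤-Reasoning
  0≤1 : 0ℤ ≤ 1ℤ
  0≤1 = +≤+ ℕ.z≤n
  0≤q = ≤-trans 0≤1 1≤q
  0≤X = ≤-trans 0≤1 1≤X
  0≤q² = *-nonNeg 0≤q 0≤q
  0≤q³ = *-nonNeg 0≤q 0≤q²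
  cube-mono : ∀ {a b} → 0ℤ ≤ a → a ≤ b → a * (a * a) ≤ b * (b * b)
  cube-mono 0≤a a≤b = *-mono 0≤a (*-nonNeg 0≤b 0≤b) a≤b (*-mono 0≤a 0≤b a≤b a≤b)
    where 0≤b = ≤-trans 0≤a a≤b
  1≤qXX : 1ℤ ≤ q * (X * X)
  1≤qXX = *-mono 0≤1 (*-nonNeg 0≤X 0≤X) 1≤q (*-mono 0≤1 0≤X 1≤X 1≤X)
  -- Otherwise `l` would be at most 1, against `l³ ≥ 1000`. Positivity of `m` then absorbs the extra
  -- 1 in `l ≤ m + 1` into `l ≤ 2m`.
  ¬m≤0 : ¬ m ≤ 0ℤ
  ¬m≤0 m≤0 = 1000≰1 (begin
    + 1000                    ≤⟨ *-monoˡ {k = + 1000} (+≤+ ℕ.z≤n) 1≤qXX ⟩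
    + 1000 * (q * (X * X))    ≤⟨ large ⟩
    l * (l * l)               ≤⟨ cube-mono 0≤l (≤-trans l≤m+1 (+-monoˡ-≤ 1ℤ m≤0)) ⟩
    1ℤ                        ∎)
    where
    1000≰1 : ¬ + 1000 ≤ 1ℤ
    1000≰1 (+≤+ (ℕ.s≤s ()))
  1≤m : 1ℤ ≤ m
  1≤m = i<j⇒suc[i]≤j (≰⇒> ¬m≤0)
  l≤2m : l ≤ + 2 * m
  l≤2m = ≤-trans l≤m+1 (≤-trans (+-monoʳ-≤ m 1≤m) (≤-reflexive (double m)))
  -- The constant 125 is 1000 divided by the 8 from `(2m)³`.
  large-m : + 125 * (q * (X * X)) ≤ m * (m * m)
  large-m = *-cancelˡ-≤-pos _ _ (+ 8) (begin
    + 8 * (+ 125 * (q * (X * X)))          ≡⟨ sym (*-assoc (+ 8) (+ 125) (q * (X * X))) ⟩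
    + 1000 * (q * (X * X))                 ≤⟨ large ⟩
    l * (l * l)                            ≤⟨ cube-mono 0≤l l≤2m ⟩
    (+ 2 * m) * ((+ 2 * m) * (+ 2 * m))    ≡⟨ cube-double m ⟩
    + 8 * (m * (m * m))                    ∎)
    where
    cube-double : ∀ m → (+ 2 * m) * ((+ 2 * m) * (+ 2 * m)) ≡ + 8 * (m * (m * m))
    cube-double = solve-∀
  0<X = <-≤-trans (+<+ (ℕ.s≤s ℕ.z≤n)) 1≤X
  0<m = <-≤-trans (+<+ (ℕ.s≤s ℕ.z≤n)) 1≤m
  large-m² : + 125 * (q * X) ≤ m * m
  large-m² = *-cancelˡ-≤-pos _ _ X {{positive 0<X}} (begin
    X * (+ 125 * (q * X))      ≡⟨ rearrange X q ⟩
    + 125 * (q * (X * X))      ≤⟨ large-m ⟩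
    m * (m * m)                ≤⟨ *-monoʳ (*-nonNeg 0≤m 0≤m) m≤X ⟩
    X * (m * m)                ∎)
    where
    rearrange : ∀ X q → X * (+ 125 * (q * X)) ≡ + 125 * (q * (X * X))
    rearrange = solve-∀
  m⁶ : ℤ
  m⁶ = (m * m) * ((m * m) * (m * m))
  0<m⁶ : 0ℤ < m⁶
  0<m⁶ = *-pos (*-pos 0<m 0<m) (*-pos (*-pos 0<m 0<m) (*-pos 0<m 0<m))
  n³≤q³ : n * (n * n) ≤ q * (q * q)
  n³≤q³ = cube-mono 0≤n n≤q
  -- The energy term is `4 q³ m³` times `q X²`, and the variance term is `2 m⁴ n³` times `q X`. By
  -- `large-m` and `large-m²` they are at most `4/125` and `2/125` of `m⁶ q³`.
  deficit : + 125 * (n * (n * n) - τ) ≤ + 6 * (q * (q * q))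
  deficit = *-cancelˡ-≤-pos _ _ m⁶ {{positive 0<m⁶}} (begin
    m⁶ * (+ 125 * (n * (n * n) - τ))
      ≡⟨ exchange m⁶ (+ 125) (n * (n * n) - τ) ⟩
    + 125 * (m⁶ * (n * (n * n) - τ))
      ≤⟨ *-monoˡ {k = + 125} (+≤+ ℕ.z≤n) bound ⟩
    + 125 * ((+ 2 * (q * q)) * (+ 2 * (((q * q) * (X * X)) * (m * (m * m)))) + (+ 2 * (m * m)) * ((n * n) * (m * ((q * (X * n)) * m))))
      ≡⟨ collect (+ 125) q X n m ⟩
    (+ 4 * ((q * (q * q)) * (m * (m * m)))) * (+ 125 * (q * (X * X))) + ((+ 2 * ((m * m) * (m * m))) * (n * (n * n))) * (+ 125 * (q * X))
      ≤⟨ +-mono-≤ (*-monoˡ (*-nonNeg {+ 4} (+≤+ ℕ.z≤n) (*-nonNeg 0≤q³ (*-nonNeg 0≤m (*-nonNeg 0≤m 0≤m)))) large-m)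
           (*-mono (*-nonNeg 0≤2m⁴ (*-nonNeg 0≤n (*-nonNeg 0≤n 0≤n))) (*-nonNeg 0≤m 0≤m) (*-monoˡ 0≤2m⁴ n³≤q³) large-m²) ⟩
    (+ 4 * ((q * (q * q)) * (m * (m * m)))) * (m * (m * m)) + ((+ 2 * ((m * m) * (m * m))) * (q * (q * q))) * (m * m)
      ≡⟨ total (q * (q * q)) m ⟩
    m⁶ * (+ 6 * (q * (q * q))) ∎)
    where
    0≤2m⁴ : 0ℤ ≤ + 2 * ((m * m) * (m * m))
    0≤2m⁴ = *-nonNeg {+ 2} (+≤+ ℕ.z≤n) (*-nonNeg (*-nonNeg 0≤m 0≤m) (*-nonNeg 0≤m 0≤m))
    collect : ∀ k q X n m → k * ((+ 2 * (q * q)) * (+ 2 * (((q * q) * (X * X)) * (m * (m * m)))) + (+ 2 * (m * m)) * ((n * n) * (m * ((q * (X * n)) * m))))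
      ≡ (+ 4 * ((q * (q * q)) * (m * (m * m)))) * (k * (q * (X * X))) + ((+ 2 * ((m * m) * (m * m))) * (n * (n * n))) * (k * (q * X))
    collect = solve-∀
    total : ∀ c m → (+ 4 * (c * (m * (m * m)))) * (m * (m * m)) + ((+ 2 * ((m * m) * (m * m))) * c) * (m * m) ≡ ((m * m) * ((m * m) * (m * m))) * (+ 6 * c)
    total = solve-∀
  -- Eight times `deficit` together with `q³ ≤ 8 n³` leaves `125 - 48 = 77`.
  77q³≤1000τ : + 77 * (q * (q * q)) ≤ + 1000 * τ
  77q³≤1000τ = 0≤i-j⇒j≤i (subst (0ℤ ≤_) (combine (q * (q * q)) n τ) (+-mono-≤
    (*-monoˡ {k = + 8} (+≤+ ℕ.z≤n) (i≤j⇒0≤j-i deficit)) (*-monoˡ {k = + 125} (+≤+ ℕ.z≤n) (i≤j⇒0≤j-i (cube-mono 0≤q q≤2n)))))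
    where
    combine : ∀ c n τ → + 8 * (+ 6 * c - + 125 * (n * (n * n) - τ)) + + 125 * ((+ 2 * n) * ((+ 2 * n) * (+ 2 * n)) - c) ≡ + 1000 * τ - + 77 * c
    combine = solve-∀

-- From the moment bounds to the number of attained triples.

module Count (F : FiniteField) (d : ℕ) (B : Vect F d → Vect F d → FiniteField.Carrier F)
  (bilinear : IsBilinear F d B) (nondegenerate : IsNonDegenerate F d B)
  (E : List (Vect F d)) (E! : Unique E) where

  open VectorSpace F d
  open DecMembership _≟ⱽ_ using () renaming (_∈?_ to _∈ⱽ?_)
  open DecMembership (_≟³_ F) using () renaming (_∈?_ to _∈³?_)

  -- The zero vector is removed from `E` because its form values are not equidistributed.
  S? : Decidable (λ x → x ∈ E × x ≢ 0ⱽ)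
  S? x = (x ∈ⱽ? E) ×-dec ¬? (x ≟ⱽ 0ⱽ)

  open Energy F d B bilinear nondegenerate S? (λ 0∈S → proj₂ 0∈S refl)

  triples : List (K × K × K)
  triples = triangleTriples F B E

  attained : K → T → ℤ
  attained c (a , b) = ⟦ (a , b , c) ∈³? triples ⟧

  -- Only triples of units are counted. There are `n³` of them, at least `q³ / 8` by `q≤2n`, so this
  -- restriction costs a constant factor.
  τ : ℤ
  τ = ∑[ c ∈ Us ] ∑[ s ∈ Ts ] attained c s

  ∈triples : ∀ {x y z} → x ∈ E → y ∈ E → z ∈ E → (B x y , B y z , B z x) ∈ triples
  ∈triples x∈ y∈ z∈ = ∈-deduplicate⁺ (_≟³_ F) (∈-map⁺ _ (∈-cartesianProduct⁺ x∈ (∈-cartesianProduct⁺ y∈ z∈)))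

  attained-dec : ∀ c s → attained c s ≡ 1ℤ ⊎ attained c s ≡ 0ℤ × D c s ≡ - (pairs c * m)
  attained-dec c (a , b) with (a , b , c) ∈³? triples
  ... | yes _ = inj₁ refl
  ... | no ∉  = inj₂ (refl , D-unattained λ { (x∈ , _) (y∈ , _) (z∈ , _) (refl , refl , refl) → ∉ (∈triples x∈ y∈ z∈) })

  τ≤numTriples : τ ≤ + numTriples F B E
  τ≤numTriples = begin
    (∑[ c ∈ Us ] ∑[ s ∈ Ts ] attained c s)
      ≡⟨ ∑-swap Us Ts attained ⟩
    (∑[ s ∈ Ts ] ∑[ c ∈ Us ] attained c s)
      ≡⟨ sym (∑-cartesianProduct Ts Us (λ p → attained (proj₂ p) (proj₁ p))) ⟩
    (∑[ p ∈ cartesianProduct Ts Us ] attained (proj₂ p) (proj₁ p))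
      ≡⟨ sym (∑-map (cartesianProduct Ts Us) assoc _) ⟩
    (∑[ p ∈ map assoc (cartesianProduct Ts Us) ] ⟦ p ∈³? triples ⟧)
      ≤⟨ ∑-membership≤length (_≟³_ F) triples (Unique.map⁺ (λ { refl → refl }) (Unique.cartesianProduct⁺ Ts! Us!)) bound ⟩
    + numTriples F B E ∎
    where
    open ≤-Reasoning
    assoc : T × K → K × K × K
    assoc ((a , b) , c) = a , b , c
    bound : ∀ p → ⟦ p ∈³? triples ⟧ ≤ (∑[ l ∈ triples ] ⟦ _≟³_ F p l ⟧)
    bound p with p ∈³? triples
    ... | yes p∈ = 1≤∑-⟦⟧ (_≟³_ F) p∈
    ... | no _   = ∑-nonNeg triples λ l → ⟦⟧-nonNeg (_≟³_ F p l)

  -- The extra 1 accounts for the zero vector, which `E` may contain.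
  length≤m+1 : + length E ≤ m + 1ℤ
  length≤m+1 = begin
    + length E                         ≤⟨ ∑-membership≥length _≟ⱽ_ Xs! E! (λ _ → ∈vectors _) bound ⟩
    (∑[ x ∈ Xs ] (e x + ⟦ x ≟ⱽ 0ⱽ ⟧))  ≡⟨ trans (∑-+ Xs e _) (cong (λ u → m + u) (∑-⟦⟧-unique _≟ⱽ_ Xs! (∈vectors 0ⱽ))) ⟩
    m + 1ℤ                             ∎
    where
    open ≤-Reasoning
    bound : ∀ x → (x ∈ E → 1ℤ ≤ e x + ⟦ x ≟ⱽ 0ⱽ ⟧) × 0ℤ ≤ e x + ⟦ x ≟ⱽ 0ⱽ ⟧
    bound x = covered , +-mono-≤ (e-nonNeg x) (⟦⟧-nonNeg (x ≟ⱽ 0ⱽ))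
      where
      covered : x ∈ E → 1ℤ ≤ e x + ⟦ x ≟ⱽ 0ⱽ ⟧
      covered x∈E with x ≟ⱽ 0ⱽ in eq
      ... | yes x≡0 = +-mono-≤ (⟦⟧-nonNeg ((x ∈ⱽ? E) ×-dec ¬? (yes x≡0))) ≤-refl
      ... | no x≢0  = +-mono-≤ (≤-reflexive (sym (⟦⟧-true ((x ∈ⱽ? E) ×-dec ¬? (no x≢0)) (x∈E , x≢0)))) ≤-refl

  m≤card : m ≤ card Xs
  m≤card = ∑-mono Xs e≤1

  n≤q : n ≤ q
  n≤q = ≤-trans (≤-reflexive (∑-filter nonzero? Ks (λ _ → 1ℤ)))
    (∑-mono Ks λ a → ≤-trans (≤-reflexive (*-identityʳ _)) (⟦⟧≤1 (nonzero? a)))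

  -- Zero is the only nonunit, so `q` is at most `n + 1`, and `1ᴷ` shows that `n` is at least 1.
  q≤2n : q ≤ + 2 * n
  q≤2n = begin
    q
      ≤⟨ ∑-mono Ks (λ a → split a (a ≟ 0ᴷ)) ⟩
    (∑[ a ∈ Ks ] (⟦ nonzero? a ⟧ * 1ℤ + ⟦ a ≟ 0ᴷ ⟧))
      ≡⟨ trans (∑-+ Ks _ _) (cong₂ _+_ (sym (∑-filter nonzero? Ks (λ _ → 1ℤ))) (∑-⟦⟧-unique _≟_ Ks! (∈Ks 0ᴷ))) ⟩
    n + 1ℤ
      ≤⟨ +-monoʳ-≤ n (i<j⇒suc[i]≤j (0<card 1∈Us)) ⟩
    n + n
      ≡⟨ double n ⟩
    + 2 * n ∎
    where
    open ≤-Reasoning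
    split : ∀ a (p : Dec (a ≡ 0ᴷ)) → 1ℤ ≤ ⟦ ¬? p ⟧ * 1ℤ + ⟦ p ⟧
    split a (yes _) = ≤-refl
    split a (no _)  = ≤-refl

  private
    o = FiniteField.order F

  q≡o : q ≡ + o
  q≡o = card≡length Ks

  Xs≡oᵈ : card Xs ≡ + (o ℕ.^ d)
  Xs≡oᵈ = trans (card≡length Xs) (cong +_ (length-vectors d))

  positive-proportion : + 1000 * (+ o * (+ (o ℕ.^ d) * + (o ℕ.^ d))) ≤ + length E * (+ length E * + length E) →
    + o * (+ o * + o) ≤ + 16 * + numTriples F B E
  positive-proportion large = subst (λ u → u * (u * u) ≤ + 16 * + numTriples F B E) q≡o (≤-trans
    (size-arithmetic {q} {n} {card Xs} {m} {+ length E} {τ} (i<j⇒suc[i]≤j (0<card (∈Ks 0ᴷ))) (card-nonNeg Us) q≤2n n≤q (i<j⇒suc[i]≤j (0<card (∈vectors {d} 0ⱽ))) m≥0 m≤card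
      (+≤+ ℕ.z≤n) length≤m+1 (∑-nonNeg Us λ c → ∑-nonNeg Ts λ { (a , b) → ⟦⟧-nonNeg ((a , b , c) ∈³? triples) }) large′ bound)
    (*-monoˡ {k = + 16} (+≤+ ℕ.z≤n) τ≤numTriples))
    where
    large′ : + 1000 * (q * (card Xs * card Xs)) ≤ + length E * (+ length E * + length E)
    rescale : ∀ k {u u′ v v′ w} → u ≡ u′ → v ≡ v′ → k * (u′ * (v′ * v′)) ≤ w → k * (u * (v * v)) ≤ w
    rescale k refl refl h = h
    large′ = rescale (+ 1000) {q} {+ o} {card Xs} {+ (o ℕ.^ d)} q≡o Xs≡oᵈ large
    m⁶ k : ℤ
    m⁶ = (m * m) * ((m * m) * (m * m))
    k = (+ 2 * (q * q)) * (+ 2 * (((q * q) * (card Xs * card Xs)) * (m * (m * m))))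
    bound : m⁶ * (n * (n * n) - τ) ≤ k + (+ 2 * (m * m)) * ((n * n) * (m * ((q * (card Xs * n)) * m)))
    bound = subst (λ M → m⁶ * (n * (n * n) - τ) ≤ k + (+ 2 * (m * m)) * ((n * n) * (m * ((q * M) * m))))
      (card-cartesianProduct Xs Us) (unattained-bound attained attained-dec)

-- Passage from integers to natural numbers.

pos-cube : ∀ k → + (k ℕ.^ 3) ≡ + k * (+ k * + k)
pos-cube k = trans (cong (λ l → + (k ℕ.* (k ℕ.* l))) (ℕP.*-identityʳ k))
  (trans (pos-* k (k ℕ.* k)) (cong (+ k *_) (pos-* k k)))

-- Three times the exponent `d - (d - 1) / 3` is `2 d + 1`: cubing the size hypothesis clears the
-- fraction and yields `q` times the square of the number of vectors.
^-2d+1 : ∀ o d → o ℕ.^ (2 ℕ.* d ℕ.+ 1) ≡ o ℕ.* (o ℕ.^ d ℕ.* o ℕ.^ d)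
^-2d+1 o d = trans (cong (o ℕ.^_) (trans (ℕP.+-comm (2 ℕ.* d) 1) (cong (λ l → ℕ.suc (d ℕ.+ l)) (ℕP.+-identityʳ d))))
  (cong (o ℕ.*_) (ℕP.^-distribˡ-+-* o d d))

-- Here `C` stands for the constant after cubing.
size-hypothesis : ∀ C o d l → C ℕ.* (o ℕ.^ (2 ℕ.* d ℕ.+ 1)) ℕ.≤ l ℕ.^ 3 →
  + C * (+ o * (+ (o ℕ.^ d) * + (o ℕ.^ d))) ≤ + l * (+ l * + l)
size-hypothesis C o d l large = begin
  + C * (+ o * (+ (o ℕ.^ d) * + (o ℕ.^ d)))   ≡⟨ cong (λ u → + C * (+ o * u)) (sym (pos-* (o ℕ.^ d) (o ℕ.^ d))) ⟩
  + C * (+ o * + (o ℕ.^ d ℕ.* o ℕ.^ d))       ≡⟨ cong (+ C *_) (sym (pos-* o _)) ⟩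
  + C * + (o ℕ.* (o ℕ.^ d ℕ.* o ℕ.^ d))       ≡⟨ sym (pos-* C _) ⟩
  + (C ℕ.* (o ℕ.* (o ℕ.^ d ℕ.* o ℕ.^ d)))     ≡⟨ cong (λ u → + (C ℕ.* u)) (sym (^-2d+1 o d)) ⟩
  + (C ℕ.* (o ℕ.^ (2 ℕ.* d ℕ.+ 1)))           ≤⟨ +≤+ large ⟩
  + (l ℕ.^ 3)                                 ≡⟨ pos-cube l ⟩
  + l * (+ l * + l)                           ∎
  where open ≤-Reasoning

triples-conclusion : ∀ N o t → + o * (+ o * + o) ≤ + N * + t → o ℕ.^ 3 ℕ.≤ N ℕ.* t
triples-conclusion N o t bound = drop‿+≤+ (≤-trans (≤-reflexive (pos-cube o)) (≤-trans bound (≤-reflexive (sym (pos-* N t)))))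

theorem1p3 : (d : ℕ) → 2 ℕ.≤ d →
    Σ[ C ∈ ℕ ] Σ[ N ∈ ℕ ] (1 ℕ.≤ C × 1 ℕ.≤ N ×
    ((F : FiniteField) →
    (B : Vec (FiniteField.Carrier F) d → Vec (FiniteField.Carrier F) d → FiniteField.Carrier F) →
    IsBilinear F d B → IsNonDegenerate F d B →
    (E : List (Vec (FiniteField.Carrier F) d)) → Unique E →
    (C ℕ.^ 3) ℕ.* (FiniteField.order F ℕ.^ (2 ℕ.* d ℕ.+ 1)) ℕ.≤ length E ℕ.^ 3 →
    FiniteField.order F ℕ.^ 3 ℕ.≤ N ℕ.* numTriples F B E))
-- The value 10 is the cube root of the 1000 in `size-arithmetic`, and 16 is the reciprocal of the
-- proportion of triples obtained there.
theorem1p3 d _ = 10 , 16 , ℕ.s≤s ℕ.z≤n , ℕ.s≤s ℕ.z≤n , λ F B bilinear nondegenerate E E! large →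
  triples-conclusion 16 (FiniteField.order F) (numTriples F B E)
    (Count.positive-proportion F d B bilinear nondegenerate E E!
      (size-hypothesis 1000 (FiniteField.order F) d (length E) large))
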